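{- For any positive integers $s\geq 2$ and $k$, there is a positive constant $c=c(k,s)$ such that for every integer $t>(s-1)!$, if $n$ is sufficiently large (in terms of $k,s,t$), then $$\mathrm{ex}(n,K_{s,t}^{(2k)})\geq c\,t^{\frac{1}{s-1}}n^{2k-\frac{1}{s-1}}.$$
   Context: For an $r$-uniform hypergraph $H$, $\mathrm{ex}(n,H)$ denotes the largest number of edges in an $r$-uniform hypergraph on $n$ vertices containing no copy of $H$ (as a not necessarily induced subhypergraph). For positive integers $r,s,t$, $K_{s,t}^{(r)}$ denotes the $r$-uniform hypergraph whose vertex set is the union of pairwise disjoint sets $X,Y_1,\dots,Y_t$ with $|X|=s$ and $|Y_1|=\dots=|Y_t|=r-1$, and whose edge set is $\{\{x\}\cup Y_i : x\in X,\ 1\leq i\leq t\}$. Here $r=2k$. -}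

module Defs where

open import Data.Bool.Properties as Bool using ()
open import Data.Fin as Fin using (Fin; zero; suc)
open import Data.Fin.Properties using (any?; all?)
open import Data.Fin.Subset using (Subset; inside; outside; ∣_∣; ⁅_⁆; ⊥; ⊤)
open import Data.Fin.Subset.Properties using (∣⁅x⁆∣≡1; ∣⊥∣≡0; ∣⊤∣≡n)
  renaming (_∈?_ to _∈ˢ?_)
open import Data.List using
  (List; []; _∷_; _++_; length; map; filter; mapMaybe; deduplicate; allFin; cartesianProductWith)
open import Data.List.Extrema.Nat using (max; xs≤max; argmax-sel)
open import Data.List.Membership.Propositional using (_∈_)
open import Data.List.Membership.Propositional.Properties using
  (∈-map⁺; ∈-map⁻; ∈-++⁺ˡ; ∈-++⁺ʳ; ∈-++⁻; ∈-filter⁺; ∈-filter⁻; ∈-∃++;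
   ∈-deduplicate⁻; ∈-cartesianProductWith⁻)
open import Data.List.Properties using (length-++-sucʳ)
open import Data.List.Relation.Binary.Subset.Propositional using (_⊆_)
open import Data.List.Relation.Unary.All as All using (All; []; _∷_)
open import Data.List.Relation.Unary.AllPairs using ([]; _∷_)
open import Data.List.Relation.Unary.Any using (here; there)
open import Data.List.Relation.Unary.Unique.Propositional using (Unique)
import Data.List.Relation.Unary.Unique.Propositional.Properties as Unique
open import Data.Maybe using (Maybe; just; nothing)
open import Data.Nat using (ℕ; zero; suc; _+_; _*_; _∸_; _≤_; z≤n; s≤s; NonZero)
open import Data.Nat.Properties as ℕ using ()
open import Data.Product using (∃; _×_; _,_; proj₁; proj₂)
open import Data.Sum using (inj₁; inj₂)
open import Data.Vec as Vec using ([]; _∷_; tabulate; concat; replicate; _[_]≔_)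
open import Data.Vec.Properties using (≡-dec; tabulate-cong; ∷-injectiveʳ)
import Data.Vec.Functional as F
open import Function using (_∘_)
open import Function.Definitions using (Injective)
open import Relation.Binary using (DecidableEquality)
open import Relation.Binary.PropositionalEquality
open import Relation.Nullary using
  (¬_; ¬?; Dec; yes; no; does; map′; _×-dec_; _→-dec_; contradiction)
open import Relation.Nullary.Decidable using (does-⇔)
open import Relation.Unary using (Decidable)
import Data.List.Membership.DecPropositional as DecMembership
import Data.List.Relation.Unary.Unique.DecPropositional as DecUnique
import Data.List.Relation.Unary.Unique.DecPropositional.Properties as DecUnique

open import Data.Rational using (+-*-rawSemiring)
open import Algebra.Definitions.RawSemiring +-*-rawSemiring public
  using () renaming (_^_ to _^ℚ_)

private
  variable
    m n r : ℕ
    A : Set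

_≟ˢ_ : DecidableEquality (Subset n)
_≟ˢ_ = ≡-dec Bool._≟_

private
  _∈?_ : (e : Subset n) (es : List (Subset n)) → Dec (e ∈ es)
  _∈?_ = DecMembership._∈?_ _≟ˢ_

record Hypergraph (r n : ℕ) : Set where
  constructor hypergraph
  field
    edges    : List (Subset n)
    uniform  : All (λ e → ∣ e ∣ ≡ r) edges
    distinct : Unique edges

  size : ℕ
  size = length edges

open Hypergraph public

image : (Fin m → Fin n) → Subset m → Subset n
image f p = tabulate λ y → does (any? λ x → (x ∈ˢ? p) ×-dec (f x Fin.≟ y))

IsCopy : Hypergraph r m → Hypergraph r n → (Fin m → Fin n) → Set
IsCopy H G f = Injective _≡_ _≡_ f × All (λ e → image f e ∈ edges G) (edges H)

-- G contains a (not necessarily induced) copy of H.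
_⊑_ : Hypergraph r m → Hypergraph r n → Set
H ⊑ G = ∃ (IsCopy H G)

private
  anyFunction? : {P : (Fin m → Fin n) → Set} →
    (∀ {f g} → f ≗ g → P f → P g) → Decidable P → Dec (∃ P)
  anyFunction? {m = zero} resp P? =
    map′ (λ p → F.[] , p) (λ (f , p) → resp (λ ()) p) (P? F.[])
  anyFunction? {m = suc m} {P = P} resp P? =
    map′ (λ (x , g , p) → x F.∷ g , p)
         (λ (f , p) → f zero , f ∘ suc , resp (λ { zero → refl ; (suc i) → refl }) p)
         (any? λ x → anyFunction? (λ f≗g → resp λ { zero → refl ; (suc i) → f≗g i })
                                  (λ g → P? (x F.∷ g)))

  image-cong : {f g : Fin m → Fin n} → f ≗ g → ∀ p → image f p ≡ image g p
  image-cong {f = f} {g} f≗g p = tabulate-cong λ y → does-⇔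
    (record
      { to = λ (x , x∈p , fx≡y) → x , x∈p , trans (sym (f≗g x)) fx≡y
      ; from = λ (x , x∈p , gx≡y) → x , x∈p , trans (f≗g x) gx≡y
      ; to-cong = cong _ ; from-cong = cong _ })
    (any? λ x → (x ∈ˢ? p) ×-dec (f x Fin.≟ y))
    (any? λ x → (x ∈ˢ? p) ×-dec (g x Fin.≟ y))

  IsCopy-resp : (H : Hypergraph r m) (G : Hypergraph r n) →
    ∀ {f g} → f ≗ g → IsCopy H G f → IsCopy H G g
  IsCopy-resp H G f≗g (inj , cs) =
    (λ {x} {y} gx≡gy → inj (trans (f≗g x) (trans gx≡gy (sym (f≗g y))))) ,
    All.map (λ {e} → subst (_∈ edges G) (image-cong f≗g e)) cs

  injective? : Decidable (λ (f : Fin m → Fin n) → Injective _≡_ _≡_ f)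
  injective? f = map′ (λ h {x} {y} → h x y) (λ h x y → h)
    (all? λ x → all? λ y → (f x Fin.≟ f y) →-dec (x Fin.≟ y))

_⊑?_ : (H : Hypergraph r m) (G : Hypergraph r n) → Dec (H ⊑ G)
H ⊑? G = anyFunction? (IsCopy-resp H G)
  (λ f → injective? f ×-dec All.all? (λ e → image f e ∈? edges G) (edges H))

subsets : ∀ n → List (Subset n)
subsets zero    = [] ∷ []
subsets (suc n) = map (inside ∷_) (subsets n) ++ map (outside ∷_) (subsets n)

sublists : List A → List (List A)
sublists []       = [] ∷ []
sublists (x ∷ xs) = map (x ∷_) (sublists xs) ++ sublists xs

fromEdges : ∀ r → List (Subset n) → Maybe (Hypergraph r n)
fromEdges r es with All.all? (λ e → ∣ e ∣ ℕ.≟ r) es | DecUnique.unique? _≟ˢ_ es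
... | yes u | yes d = just (hypergraph es u d)
... | _     | _     = nothing

-- Every r-uniform hypergraph on Fin n occurs here, up to the order in which
-- its edges are listed.
hypergraphs : ∀ r n → List (Hypergraph r n)
hypergraphs r n = mapMaybe (fromEdges r) (sublists (subsets n))

-- The default value 0 is only relevant when no H-free hypergraph exists, which
-- requires H to have no edges; see ex-upper and ex-attained.
ex : ℕ → Hypergraph r m → ℕ
ex {r = r} n H = max 0 (map size (filter (λ G → ¬? (H ⊑? G)) (hypergraphs r n)))

private
  ∈-subsets : (p : Subset n) → p ∈ subsets n
  ∈-subsets []            = here refl
  ∈-subsets (inside ∷ p)  = ∈-++⁺ˡ (∈-map⁺ (inside ∷_) (∈-subsets p))
  ∈-subsets (outside ∷ p) = ∈-++⁺ʳ _ (∈-map⁺ (outside ∷_) (∈-subsets p))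

  subsets-! : ∀ n → Unique (subsets n)
  subsets-! zero    = [] ∷ []
  subsets-! (suc n) = Unique.++⁺
    (Unique.map⁺ ∷-injectiveʳ (subsets-! n))
    (Unique.map⁺ ∷-injectiveʳ (subsets-! n))
    λ (p , q) → disjoint (∈-map⁻ _ p) (∈-map⁻ _ q)
    where
    disjoint : ∀ {v} → ∃ (λ p → p ∈ subsets n × v ≡ inside ∷ p) →
               ¬ ∃ (λ q → q ∈ subsets n × v ≡ outside ∷ q)
    disjoint (_ , _ , refl) (_ , _ , ())

  filter∈sublists : {P : A → Set} (P? : Decidable P) →
    ∀ xs → filter P? xs ∈ sublists xs
  filter∈sublists P? [] = here refl
  filter∈sublists P? (x ∷ xs) with P? x
  ... | yes _ = ∈-++⁺ˡ (∈-map⁺ (x ∷_) (filter∈sublists P? xs))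
  ... | no  _ = ∈-++⁺ʳ _ (filter∈sublists P? xs)

  ∈-mapMaybe⁺ : {B : Set} (f : A → Maybe B) → ∀ {x y xs} →
    x ∈ xs → f x ≡ just y → y ∈ mapMaybe f xs
  ∈-mapMaybe⁺ f {x} (here refl) eq rewrite eq = here refl
  ∈-mapMaybe⁺ f {xs = z ∷ _} (there x∈) eq with f z
  ... | just _  = there (∈-mapMaybe⁺ f x∈ eq)
  ... | nothing = ∈-mapMaybe⁺ f x∈ eq

  fromEdges-complete : ∀ {es : List (Subset n)} → All (λ e → ∣ e ∣ ≡ r) es →
    Unique es → ∃ λ G → fromEdges r es ≡ just G × edges G ≡ es
  fromEdges-complete {r = r} {es} u d
    with All.all? (λ e → ∣ e ∣ ℕ.≟ r) es | DecUnique.unique? _≟ˢ_ es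
  ... | yes _ | yes _ = _ , refl , refl
  ... | no ¬u | _     = contradiction u ¬u
  ... | yes _ | no ¬d = contradiction d ¬d

  Unique-⊆-length : {xs ys : List A} → Unique xs → xs ⊆ ys → length xs ≤ length ys
  Unique-⊆-length [] _ = z≤n
  Unique-⊆-length {xs = x ∷ xs} (x∉ ∷ d) sub with ∈-∃++ (sub (here refl))
  ... | ys , zs , refl = subst (suc (length xs) ≤_) (sym (length-++-sucʳ ys x zs))
    (s≤s (Unique-⊆-length d λ {z} z∈ → drop z∈ (∈-++⁻ ys (sub (there z∈)))))
    where
    drop : ∀ {z} → z ∈ xs → _ → z ∈ ys ++ zs
    drop z∈ (inj₁ z∈ys)         = ∈-++⁺ˡ z∈ys
    drop z∈ (inj₂ (here refl))  = contradiction refl (All.lookup x∉ z∈)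
    drop z∈ (inj₂ (there z∈zs)) = ∈-++⁺ʳ ys z∈zs

ex-upper : (H : Hypergraph r m) (G : Hypergraph r n) → ¬ H ⊑ G → size G ≤ ex n H
ex-upper {r = r} {n = n} H G free =
  ℕ.≤-trans (Unique-⊆-length (distinct G) G⊆G')
            (All.lookup (xs≤max 0 _) (∈-map⁺ size (∈-filter⁺ _ G'∈ free')))
  where
  es : List (Subset n)
  es = filter (_∈? edges G) (subsets n)

  built : ∃ λ G' → fromEdges r es ≡ just G' × edges G' ≡ es
  built = fromEdges-complete
    (All.tabulate λ e∈ → All.lookup (uniform G)
      (proj₂ (∈-filter⁻ (_∈? edges G) {xs = subsets n} e∈)))
    (Unique.filter⁺ (_∈? edges G) (subsets-! n))

  G' : Hypergraph r n
  G' = proj₁ built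

  G'∈ : G' ∈ hypergraphs r n
  G'∈ = ∈-mapMaybe⁺ (fromEdges r) (filter∈sublists (_∈? edges G) (subsets n))
    (proj₁ (proj₂ built))

  G⊆G' : edges G ⊆ edges G'
  G⊆G' {e} e∈ = subst (e ∈_) (sym (proj₂ (proj₂ built)))
    (∈-filter⁺ (_∈? edges G) (∈-subsets e) e∈)

  G'⊆G : edges G' ⊆ edges G
  G'⊆G {e} e∈ = proj₂ (∈-filter⁻ (_∈? edges G) {xs = subsets n}
    (subst (e ∈_) (proj₂ (proj₂ built)) e∈))

  free' : ¬ H ⊑ G'
  free' (f , inj , cs) = free (f , inj , All.map G'⊆G cs)

ex-attained : (H : Hypergraph r m) → ∃ (_∈ edges H) →
  ∀ n → ∃ λ (G : Hypergraph r n) → ¬ H ⊑ G × size G ≡ ex n H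
ex-attained {r = r} H (e , e∈H) n
  with argmax-sel (λ x → x) 0 (map size (filter (λ G → ¬? (H ⊑? G)) (hypergraphs r n)))
... | inj₁ ex≡0 = hypergraph [] [] [] , free , sym ex≡0
  where
  free : ¬ H ⊑ hypergraph [] [] []
  free (f , _ , cs) with All.lookup cs e∈H
  ... | ()
... | inj₂ ex∈ with ∈-map⁻ size ex∈
... | G , G∈ , eq =
  G , proj₂ (∈-filter⁻ (λ G → ¬? (H ⊑? G)) {xs = hypergraphs r n} G∈) , sym eq

-- Among the s + t * (r ∸ 1) vertices, the first s form X and the remaining
-- ones are split into t consecutive blocks Y_i of r ∸ 1 vertices each.
-- This is the edge {x} ∪ Y_i, where q = r ∸ 1.
K-edge : ∀ s t q → Fin s → Fin t → Subset (s + t * q)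
K-edge s t q x i = ⁅ x ⁆ Vec.++ concat (replicate t ⊥ [ i ]≔ ⊤)

private
  ∣++∣ : (p : Subset m) (q : Subset n) → ∣ p Vec.++ q ∣ ≡ ∣ p ∣ + ∣ q ∣
  ∣++∣ []            q = refl
  ∣++∣ (inside ∷ p)  q = cong suc (∣++∣ p q)
  ∣++∣ (outside ∷ p) q = ∣++∣ p q

  ∣concat-⊥∣ : ∀ t q → ∣ concat (replicate t (⊥ {q})) ∣ ≡ 0
  ∣concat-⊥∣ zero    q = refl
  ∣concat-⊥∣ (suc t) q = trans (∣++∣ (⊥ {q}) _) (cong₂ _+_ (∣⊥∣≡0 q) (∣concat-⊥∣ t q))

  ∣block∣ : ∀ t q (i : Fin t) → ∣ concat (replicate t (⊥ {q}) [ i ]≔ ⊤) ∣ ≡ q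
  ∣block∣ (suc t) q zero = trans (∣++∣ (⊤ {q}) _)
    (trans (cong₂ _+_ (∣⊤∣≡n q) (∣concat-⊥∣ t q)) (ℕ.+-identityʳ q))
  ∣block∣ (suc t) q (suc i) = trans (∣++∣ (⊥ {q}) _)
    (cong₂ _+_ (∣⊥∣≡0 q) (∣block∣ t q i))

  ∣K-edge∣ : ∀ s t q x i → ∣ K-edge s t q x i ∣ ≡ suc q
  ∣K-edge∣ s t q x i = trans (∣++∣ ⁅ x ⁆ _) (cong₂ _+_ (∣⁅x⁆∣≡1 x) (∣block∣ t q i))

K-edges : ∀ s t q → List (Subset (s + t * q))
K-edges s t q = cartesianProductWith (K-edge s t q) (allFin s) (allFin t)

-- Duplicates occur only for r = 1, where all the Y_i are empty.
K : ∀ r s t .{{_ : NonZero r}} → Hypergraph r (s + t * (r ∸ 1))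
K r s t = record
  { edges    = deduplicate _≟ˢ_ (K-edges s t (r ∸ 1))
  ; uniform  = All.tabulate λ {e} e∈ → ∣edge∣ (∈-cartesianProductWith⁻ (K-edge s t (r ∸ 1))
                 (allFin s) (allFin t) (∈-deduplicate⁻ _≟ˢ_ (K-edges s t (r ∸ 1)) e∈))
  ; distinct = DecUnique.deduplicate-! _≟ˢ_ _
  }
  where
  ∣edge∣ : ∀ {e} → (∃ λ x → ∃ λ i → x ∈ allFin s × i ∈ allFin t × e ≡ K-edge s t (r ∸ 1) x i) →
           ∣ e ∣ ≡ r
  ∣edge∣ (x , i , _ , _ , refl) = trans (∣K-edge∣ s t (r ∸ 1) x i) (ℕ.suc-pred r)

{-# OPTIONS --safe #-}
module Submission where

-- Let d = s - 1. The vertices form 2k blocks, each a copy of the field F with Q = q^d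
-- elements, q a power of two, and the blocks are matched in k pairs. An edge takes one vertex
-- from each block so that the colours χ(N(x + y)) of its k pairs (x, y) add up to a fixed
-- residue; here N is the norm onto the field of order q. In a copy of K_{s,t} the vertices of X
-- lie in a single block, and their t common (2k-1)-sets meet the partner block in t distinct
-- elements y for which all χ(N(x + y)), x ∈ X, agree. The colouring χ has O(q / h) colours, and
-- two elements of the same colour have one of 4h - 3 ratios: χ assigns to v a translate
-- meeting v {1, g, ..., g^(h-1)} in a maximal family of disjoint translates of
-- {1, g, ..., g^(h-1)}. So the ratios of the N(x + y), x ∈ X, take at most (4h-3)^d values, and
-- for given ratios there are at most d! such y: the conjugates of y are the coordinates of a
-- solution of a system Π_j (p_j + a_ij) = ρ_i Π_j (p_j + a_0j), i ≤ d, whose polynomials V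
-- of multidegree (d-1, ..., 1, 0) restrict onto all functions on the solution set. Hence the
-- hypergraph is K_{s,t}-free once (4h-3)^d d! < t, which allows h of order t^(1/d).

open import Defs
open import Data.Integer using (+_)
open import Data.Nat using (ℕ; _*_; _∸_; _^_; _≤_; _<_; _!; NonZero)
open import Data.Nat.Properties using (m*n≢0)
open import Data.Product using (∃-syntax; _×_)
open import Data.Rational as ℚ using (ℚ; 0ℚ; _/_)

open import Algebra.Bundles using (CommutativeRing; RawRing)
open import Algebra.Core using (Op₂)
open import Algebra.Morphism.Structures using (IsRingMonomorphism)
open import Algebra.Solver.Ring.AlmostCommutativeRing using (AlmostCommutativeRing; fromCommutativeRing; _-Raw-AlmostCommutative⟶_)
open import Algebra.Structures using (IsCommutativeRing)
open import Data.Bool as Bool using (Bool; true; false; _xor_)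
open import Data.Bool.Properties as Bool using (xor-assoc; xor-comm; xor-same; xor-identityʳ; xor-∧-commutativeRing)
open import Data.Fin as Fin using (Fin; zero; suc; toℕ; fromℕ<; punchIn; punchOut; finToFun; funToFin; combine; remQuot; inject≤; splitAt; _↑ˡ_; _↑ʳ_)
open import Data.Fin.Properties as Fin using (any?; all?; toℕ-fromℕ<; toℕ-inject≤; toℕ-injective; toℕ<n; inject≤-injective; injective⇒≤; punchInᵢ≢i; punchIn-punchOut; punchOut-punchIn; punchOut-cong; punchIn-injective; funToFin-finToFin; finToFun-funToFin; combine-remQuot; combine-injective; combine-injectiveˡ; splitAt-↑ˡ; splitAt-↑ʳ; splitAt⁻¹-↑ˡ; splitAt⁻¹-↑ʳ; ↑ˡ-injective; ↑ʳ-injective)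
open import Data.Fin.Subset using (Subset; inside; outside; ∣_∣; ⁅_⁆; ⊥; ⊤) renaming (_∈_ to _∈ˢ_)
open import Data.Fin.Subset.Properties using (∈⊤; ∉⊥; x∈⁅x⁆; x∈⁅y⁆⇒x≡y; ⊆-antisym; ∣⊥∣≡0) renaming (_∈?_ to _∈ˢ?_)
import Data.Integer as ℤ
import Data.Integer.Properties as ℤ
open import Data.List as List using (List; []; _∷_; _++_; map; upTo; length; filter; lookup; allFin)
open import Data.List.Membership.Propositional using (_∈_)
open import Data.List.Membership.Propositional.Properties using (∈-++⁺ˡ; ∈-++⁺ʳ; ∈-++⁻; ∈-map⁺; ∈-map⁻; ∈-upTo⁺; ∈-lookup; ∈-filter⁺; ∈-filter⁻; ∈-allFin; ∈-deduplicate⁺; ∈-cartesianProductWith⁺)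
open import Data.List.Properties using (length-map)
open import Data.List.Relation.Unary.All as ListAll using ([]; _∷_)
open import Data.List.Relation.Unary.All.Properties as ListAll using (all-filter)
open import Data.List.Relation.Unary.AllPairs using (AllPairs; []; _∷_)
open import Data.List.Relation.Unary.Any as Any using (Any; here; there)
open import Data.List.Relation.Unary.Any.Properties using (lookup-index)
open import Data.List.Relation.Unary.Unique.Propositional using (Unique)
open import Data.Maybe using (Maybe; just; nothing)
open import Data.Nat as ℕ using (zero; suc; _+_; _%_; s≤s; z≤n)
open import Data.Nat.DivMod using (m%n<n; m≡m%n+[m/n]*n; m<n⇒m%n≡m; [m+n]%n≡m%n; [m+kn]%n≡m%n; %-distribˡ-+; m/n*n≤m; m*n/n≡m; /-monoˡ-≤)
open import Data.Nat.Properties as ℕ using ()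
open import Data.Nat.Solver using (module +-*-Solver)
open import Data.Product using (∃; ∃₂; _,_; proj₁; proj₂)
open import Data.Rational using (1ℚ)
import Data.Rational.Properties as ℚ
open import Data.Rational.Unnormalised using (mkℚᵘ; *≤*)
import Data.Rational.Unnormalised.Properties as ℚᵘ
open import Data.Sum as Sum using (_⊎_; inj₁; inj₂)
import Data.Unit as Unit
open import Data.Vec as Vec using (Vec; []; _∷_; _∷ʳ_; tabulate; here; there; _[_]≔_)
open import Data.Vec.Properties using ([]=⇒lookup; lookup⇒[]=; lookup∘tabulate; lookup∘update; lookup∘update′; lookup-++ˡ; lookup-++ʳ; lookup-replicate)
open import Data.Vec.Relation.Unary.All using (All; []; _∷_)
open import Function using (_∘_; id)
open import Function.Definitions using (Injective)
open import Level using (0ℓ)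
open import Relation.Binary using (Rel; Decidable; tri<; tri≈; tri>)
open import Relation.Binary.PropositionalEquality as ≡ using (_≡_; _≢_; _≗_; refl; sym; trans; cong; cong₂; subst; subst₂)
open import Relation.Nullary using (¬_; Dec; yes; no; does; contradiction; ¬?; _×-dec_)
open import Relation.Nullary.Decidable using (map′; dec-true; dec-false)
import Relation.Unary
import Algebra.Morphism.RingMonomorphism
import Algebra.Properties.CommutativeMonoid.Sum ℕ.+-0-commutativeMonoid as ∑
import Algebra.Properties.CommutativeSemiring.Exp
import Algebra.Properties.Semiring.Sum
import Algebra.Solver.Ring
import Data.List.Relation.Unary.Unique.Propositional.Properties as Unique

-- Agreement of colours fixes no norm, since the common colour varies with y; it only confines
-- ratios of norms. One vertex of X therefore serves as reference, and the remaining d = s - 1 give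
-- as many equations as y has conjugates. The exponents come from a trade-off. Grouping norms into M
-- colours, M of order q / h, lets the most frequent residue keep at least Q^(2k) / M transversals,
-- a gain of order h over one colour per norm. The price is that the bound d! on common neighbours
-- grows by a factor of order h^d only. With q = Q^(1/d), n of order Q and h of order t^(1/d), this
-- is t^(1/d) n^(2k - 1/d). The residue condition reduces 2k-uniform edges to a graph problem: edges
-- with the same (2k-1)-set differ in one block only, so all pairs but one contribute equally to the
-- sum. Powers of two remove all signs, and consecutive field orders Q differ by the factor 2^d
-- only, so some Q is within a constant factor of n. The set {1, g, ..., g^(h-1)} needs an element g
-- of order at least h in the field of order q; this is why n has to be large in terms of t.

finToFun-injective : ∀ {m n} {i j : Fin (m ^ n)} → finToFun {m} {n} i ≗ finToFun j → i ≡ j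
finToFun-injective {m} {n} {i} {j} eq = trans (sym (funToFin-finToFin {n} i)) (trans (funToFin-cong eq) (funToFin-finToFin {n} j))
  where
  funToFin-cong : ∀ {k} {f g : Fin k → Fin m} → f ≗ g → funToFin f ≡ funToFin g
  funToFin-cong {zero}  h = refl
  funToFin-cong {suc k} h = cong₂ combine (h zero) (funToFin-cong (h ∘ suc))

-- Rings of characteristic two

module CharTwo
  (R : CommutativeRing 0ℓ 0ℓ)
  (double : ∀ x → CommutativeRing._≈_ R (CommutativeRing._+_ R x x) (CommutativeRing.0# R))
  where
  open CommutativeRing R public
    renaming (_+_ to infixl 6 _⊕_; _*_ to infixl 7 _⊗_; refl to ≈-refl; sym to ≈-sym; trans to ≈-trans)
    hiding (_-_; -_; zero)
  open CommutativeRing R using (-_)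
  open Algebra.Properties.CommutativeSemiring.Exp commutativeSemiring public
    renaming (_^_ to infixr 8 _↑_)
  open import Relation.Binary.Reasoning.Setoid setoid

  private
    1≈-1 : 1# ≈ - 1#
    1≈-1 = ≈-trans (≈-sym (+-identityʳ 1#))
      (≈-trans (+-congˡ (≈-sym (-‿inverseʳ 1#)))
      (≈-trans (≈-sym (+-assoc _ _ _)) (≈-trans (+-congʳ (double 1#)) (+-identityˡ _))))

    -0≈0 : 0# ≈ - 0#
    -0≈0 = ≈-trans (≈-sym (-‿inverseʳ 0#)) (+-identityˡ _)

    bit : Bool → Carrier
    bit false = 0#
    bit true  = 1#

    ring′ : AlmostCommutativeRing 0ℓ 0ℓ
    ring′ = fromCommutativeRing R

    morphism : CommutativeRing.rawRing xor-∧-commutativeRing -Raw-AlmostCommutative⟶ ring′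
    morphism = record
      { ⟦_⟧ = bit
      ; +-homo = λ { false y → ≈-sym (+-identityˡ _) ; true false → ≈-sym (+-identityʳ _) ; true true → ≈-sym (double _) }
      ; *-homo = λ { false y → ≈-sym (zeroˡ _) ; true y → ≈-sym (*-identityˡ _) }
      ; -‿homo = λ { false → -0≈0 ; true → 1≈-1 }
      ; 0-homo = ≈-refl ; 1-homo = ≈-refl }

    bit≟ : ∀ x y → Maybe (bit x ≈ bit y)
    bit≟ false false = just ≈-refl
    bit≟ true  true  = just ≈-refl
    bit≟ _     _     = nothing

  -- With coefficients in the field of two elements, normalisation itself cancels `x ⊕ x`.
  module Solver = Algebra.Solver.Ring (CommutativeRing.rawRing xor-∧-commutativeRing) ring′ morphism bit≟
  open Solver using (solve; _:=_; _:+_; _:*_; con)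

  ⊕≈0⇒≈ : ∀ {x y} → x ⊕ y ≈ 0# → x ≈ y
  ⊕≈0⇒≈ {x} {y} eq = ≈-trans (solve 2 (λ x y → x := (x :+ y) :+ y) ≈-refl x y)
    (≈-trans (+-congʳ eq) (+-identityˡ y))

  ≈⇒⊕≈0 : ∀ {x y} → x ≈ y → x ⊕ y ≈ 0#
  ≈⇒⊕≈0 {x} {y} eq = ≈-trans (+-congʳ eq) (double y)

  frobenius : ∀ k x y → (x ⊕ y) ↑ (2 ℕ.^ k) ≈ x ↑ (2 ℕ.^ k) ⊕ y ↑ (2 ℕ.^ k)
  frobenius zero x y = solve 2 (λ x y → (x :+ y) :* con true := x :* con true :+ y :* con true) ≈-refl x y
  frobenius (suc k) x y = begin
    (x ⊕ y) ↑ (2 ℕ.* 2 ℕ.^ k)                       ≈⟨ ^-assocʳ (x ⊕ y) 2 (2 ℕ.^ k) ⟨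
    ((x ⊕ y) ↑ 2) ↑ (2 ℕ.^ k)                       ≈⟨ ^-congˡ (2 ℕ.^ k) square ⟩
    (x ↑ 2 ⊕ y ↑ 2) ↑ (2 ℕ.^ k)                     ≈⟨ frobenius k (x ↑ 2) (y ↑ 2) ⟩
    (x ↑ 2) ↑ (2 ℕ.^ k) ⊕ (y ↑ 2) ↑ (2 ℕ.^ k)       ≈⟨ +-cong (^-assocʳ x 2 (2 ℕ.^ k)) (^-assocʳ y 2 (2 ℕ.^ k)) ⟩
    x ↑ (2 ℕ.* 2 ℕ.^ k) ⊕ y ↑ (2 ℕ.* 2 ℕ.^ k)       ∎
    where
    square : (x ⊕ y) ↑ 2 ≈ x ↑ 2 ⊕ y ↑ 2
    square = solve 2 (λ x y → (x :+ y) :* ((x :+ y) :* con true) := x :* (x :* con true) :+ y :* (y :* con true)) ≈-refl x y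

  1↑ : ∀ n → 1# ↑ n ≈ 1#
  1↑ zero = ≈-refl
  1↑ (suc n) = ≈-trans (*-identityˡ _) (1↑ n)

  horner : ∀ {e} → Vec Carrier e → Carrier → Carrier
  horner []       x = 0#
  horner (c ∷ cs) x = c ⊕ x ⊗ horner cs x

  horner-∷ʳ : ∀ {e} (cs : Vec Carrier e) c x → horner (cs ∷ʳ c) x ≈ horner cs x ⊕ c ⊗ x ↑ e
  horner-∷ʳ [] c x = solve 2 (λ x c → c :+ x :* con false := con false :+ c :* con true) ≈-refl x c
  horner-∷ʳ {suc e} (a ∷ cs) c x = ≈-trans (+-congˡ (*-congˡ (horner-∷ʳ cs c x)))
    (solve 5 (λ a x h c p → a :+ x :* (h :+ c :* p) := a :+ x :* h :+ c :* (x :* p)) ≈-refl a x (horner cs x) c (x ↑ e))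

  horner-0 : ∀ e x → horner (Vec.replicate e 0#) x ≈ 0#
  horner-0 zero    x = ≈-refl
  horner-0 (suc e) x = ≈-trans (+-congˡ (*-congˡ (horner-0 e x)))
    (solve 1 (λ x → con false :+ x :* con false := con false) ≈-refl x)

  horner-+ : ∀ {e} (cs ds : Vec Carrier e) x → horner (Vec.zipWith _⊕_ cs ds) x ≈ horner cs x ⊕ horner ds x
  horner-+ [] [] x = ≈-sym (+-identityʳ 0#)
  horner-+ (c ∷ cs) (d ∷ ds) x = ≈-trans (+-congˡ (*-congˡ (horner-+ cs ds x)))
    (solve 5 (λ c d x p q → c :+ d :+ x :* (p :+ q) := c :+ x :* p :+ (d :+ x :* q)) ≈-refl c d x (horner cs x) (horner ds x))

  -- Synthetic division by `x ⊕ a`: the coefficients of the quotient are the values at `a` of the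
  -- tails of the coefficient list.
  quot : ∀ {e} → Carrier → Vec Carrier (suc e) → Vec Carrier e
  quot a (c ∷ [])           = []
  quot a (c ∷ cs@(_ ∷ _)) = horner cs a ∷ quot a cs

  horner-quot : ∀ {e} a (cs : Vec Carrier (suc e)) x →
    horner cs x ≈ horner cs a ⊕ (x ⊕ a) ⊗ horner (quot a cs) x
  horner-quot a (c ∷ []) x =
    solve 3 (λ a c x → c :+ x :* con false := c :+ a :* con false :+ (x :+ a) :* con false) ≈-refl a c x
  horner-quot a (c ∷ cs@(_ ∷ _)) x = ≈-trans (+-congˡ (*-congˡ (horner-quot a cs x)))
    (solve 5 (λ a c x h q → c :+ x :* (h :+ (x :+ a) :* q) := c :+ a :* h :+ (x :+ a) :* (h :+ x :* q))
      ≈-refl a c x (horner cs a) (horner (quot a cs) x))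

  quot-zero : ∀ {e} a (cs : Vec Carrier (suc e)) → horner cs a ≈ 0# →
    All (_≈ 0#) (quot a cs) → All (_≈ 0#) cs
  quot-zero a (c ∷ []) eq [] = ≈-trans (solve 2 (λ a c → c := c :+ a :* con false) ≈-refl a c) eq ∷ []
  quot-zero a (c ∷ cs@(_ ∷ _)) eq (h ∷ q) =
    ≈-trans (solve 2 (λ a c → c := c :+ a :* con false) ≈-refl a c)
      (≈-trans (+-congˡ (*-congˡ (≈-sym h))) eq)
    ∷ quot-zero a cs h q

  -- Lagrange's theorem for the unit group serves as definition: in the field with `n + 2` elements
  -- `x ↑ n` is the inverse of a nonzero `x`. That inversion is a power is exploited in `InV-head`.
  record IsField (n : ℕ) : Set where
    field
      1≉0  : ¬ 1# ≈ 0#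
      unit : ∀ x → x ≈ 0# ⊎ x ↑ suc n ≈ 1#

    ⊗≈0 : ∀ x y → x ⊗ y ≈ 0# → x ≈ 0# ⊎ y ≈ 0#
    ⊗≈0 x y eq with unit x
    ... | inj₁ x≈0 = inj₁ x≈0
    ... | inj₂ inv = inj₂ (begin
      y                   ≈⟨ *-identityˡ y ⟨
      1# ⊗ y              ≈⟨ *-congʳ inv ⟨
      x ⊗ x ↑ n ⊗ y       ≈⟨ solve 3 (λ x p y → x :* p :* y := p :* (x :* y)) ≈-refl x (x ↑ n) y ⟩
      x ↑ n ⊗ (x ⊗ y)     ≈⟨ *-congˡ eq ⟩
      x ↑ n ⊗ 0#          ≈⟨ zeroʳ _ ⟩
      0#                  ∎)

    x↑[2+n]≈x : ∀ x → x ↑ suc (suc n) ≈ x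
    x↑[2+n]≈x x with unit x
    ... | inj₁ x≈0 = ≈-trans (*-congʳ x≈0) (≈-trans (zeroˡ _) (≈-sym x≈0))
    ... | inj₂ inv = ≈-trans (*-congˡ inv) (*-identityʳ x)

    ⊗-cancelˡ : ∀ {x y z} → ¬ x ≈ 0# → x ⊗ y ≈ x ⊗ z → y ≈ z
    ⊗-cancelˡ {x} {y} {z} x≉0 eq with ⊗≈0 x (y ⊕ z) (≈-trans (distribˡ x y z) (≈⇒⊕≈0 eq))
    ... | inj₁ x≈0 = contradiction x≈0 x≉0
    ... | inj₂ e = ⊕≈0⇒≈ e

    ↑≈0 : ∀ n x → x ↑ n ≈ 0# → x ≈ 0#
    ↑≈0 zero x eq = contradiction eq 1≉0
    ↑≈0 (suc n) x eq with ⊗≈0 x (x ↑ n) eq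
    ... | inj₁ x≈0 = x≈0
    ... | inj₂ e = ↑≈0 n x e

    -- The conclusion concerns coefficients rather than values, because over a finite field a
    -- nonzero polynomial may vanish everywhere.
    roots⇒zero : ∀ {e} (cs : Vec Carrier e) (t : Fin e → Carrier) → (∀ {i j} → t i ≈ t j → i ≡ j) →
      (∀ i → horner cs (t i) ≈ 0#) → All (_≈ 0#) cs
    roots⇒zero {zero} [] t inj root = []
    roots⇒zero {suc e} cs t inj root = quot-zero (t zero) cs (root zero)
      (roots⇒zero (quot (t zero) cs) (λ i → t (suc i)) (λ eq → suc-inj (inj eq)) root')
      where
      suc-inj : ∀ {n} {i j : Fin n} → Fin.suc i ≡ suc j → i ≡ j
      suc-inj refl = refl
      root' : ∀ i → horner (quot (t zero) cs) (t (suc i)) ≈ 0#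
      root' i with ⊗≈0 (t (suc i) ⊕ t zero) (horner (quot (t zero) cs) (t (suc i)))
        (begin
          (t (suc i) ⊕ t zero) ⊗ horner (quot (t zero) cs) (t (suc i))                         ≈⟨ +-identityˡ _ ⟨
          0# ⊕ (t (suc i) ⊕ t zero) ⊗ horner (quot (t zero) cs) (t (suc i))                    ≈⟨ +-congʳ (root zero) ⟨
          horner cs (t zero) ⊕ (t (suc i) ⊕ t zero) ⊗ horner (quot (t zero) cs) (t (suc i))    ≈⟨ horner-quot (t zero) cs (t (suc i)) ⟨
          horner cs (t (suc i))                                                                ≈⟨ root (suc i) ⟩
          0#                                                                                   ∎)
      ... | inj₂ e = e
      ... | inj₁ e with inj (⊕≈0⇒≈ e)
      ... | ()

    -- The polynomial `x ↑ e ⊕ horner cs x` has leading coefficient 1, which more than `e` roots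
    -- would force to be 0.
    monic-roots : ∀ {e} (cs : Vec Carrier e) (t : Fin (suc e) → Carrier) →
      (∀ {i j} → t i ≈ t j → i ≡ j) → ¬ (∀ i → t i ↑ e ≈ horner cs (t i))
    monic-roots cs t inj root = 1≉0 (last cs (roots⇒zero (cs ∷ʳ 1#) t inj
        (λ i → ≈-trans (horner-∷ʳ cs 1# (t i))
          (≈-trans (+-congˡ (≈-trans (*-identityˡ _) (root i))) (double _)))))
      where
      last : ∀ {e} (cs : Vec Carrier e) → All (_≈ 0#) (cs ∷ʳ 1#) → 1# ≈ 0#
      last []       (p ∷ _) = p
      last (_ ∷ cs) (_ ∷ p) = last cs p

    constant-roots : ∀ {e} c (t : Fin (suc (suc e)) → Carrier) →
      (∀ {i j} → t i ≈ t j → i ≡ j) → ¬ (∀ i → t i ↑ suc e ≈ c)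
    constant-roots {e} c t inj root = monic-roots (c ∷ Vec.replicate e 0#) t inj
      (λ i → ≈-trans (root i) (≈-sym (≈-trans (+-congˡ (≈-trans (*-congˡ (horner-0 e (t i))) (zeroʳ _))) (+-identityʳ c))))

    fixed-roots : ∀ {e} (t : Fin (suc (suc (suc e))) → Carrier) →
      (∀ {i j} → t i ≈ t j → i ≡ j) → ¬ (∀ i → t i ↑ suc (suc e) ≈ t i)
    fixed-roots {e} t inj root = monic-roots (0# ∷ 1# ∷ Vec.replicate e 0#) t inj
      (λ i → ≈-trans (root i) (≈-sym (≈-trans (+-congˡ (*-congˡ (+-congˡ (*-congˡ (horner-0 e (t i))))))
        (solve 1 (λ x → con false :+ x :* (con true :+ x :* con false) := x) ≈-refl (t i)))))

-- The Kollár–Rónyai–Szabó bound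

module Staircase
  (R : CommutativeRing 0ℓ 0ℓ)
  (double : ∀ x → CommutativeRing._≈_ R (CommutativeRing._+_ R x x) (CommutativeRing.0# R))
  {r : ℕ} (isField : CharTwo.IsField R double r)
  where
  open CharTwo R double
  open Solver using (solve; _:=_; _:+_; _:*_; con)
  open IsField isField
  open Algebra.Properties.Semiring.Sum semiring
    using (sum; sum-cong-≋; sum-remove; *-distribˡ-sum)
  open import Relation.Binary.Reasoning.Setoid setoid

  Point : Set
  Point = ℕ → Carrier

  inv : Carrier → Carrier
  inv x = x ↑ r

  ⊗-inv : ∀ {x} → ¬ x ≈ 0# → x ⊗ inv x ≈ 1#
  ⊗-inv {x} x≉0 with unit x
  ... | inj₁ x≈0 = contradiction x≈0 x≉0
  ... | inj₂ e   = e

  Deg< : ℕ → (Carrier → Carrier) → Set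
  Deg< e f = ∃ λ (cs : Vec Carrier e) → ∀ x → f x ≈ horner cs x

  horner-scale : ∀ {e} a (cs : Vec Carrier e) x → horner (Vec.map (a ⊗_) cs) x ≈ a ⊗ horner cs x
  horner-scale a [] x = ≈-sym (zeroʳ a)
  horner-scale a (c ∷ cs) x = ≈-trans (+-congˡ (*-congˡ (horner-scale a cs x)))
    (solve 4 (λ a c x p → a :* c :+ x :* (a :* p) := a :* (c :+ x :* p)) ≈-refl a c x (horner cs x))

  Deg<-0 : ∀ e → Deg< e (λ _ → 0#)
  Deg<-0 e = Vec.replicate e 0# , λ x → ≈-sym (horner-0 e x)

  Deg<-+ : ∀ {e f g} → Deg< e f → Deg< e g → Deg< e (λ x → f x ⊕ g x)
  Deg<-+ (cs , p) (ds , q) = Vec.zipWith _⊕_ cs ds , λ x → ≈-trans (+-cong (p x) (q x)) (≈-sym (horner-+ cs ds x))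

  Deg<-scale : ∀ {e f} a → Deg< e f → Deg< e (λ x → a ⊗ f x)
  Deg<-scale a (cs , p) = Vec.map (a ⊗_) cs , λ x → ≈-trans (*-congˡ (p x)) (≈-sym (horner-scale a cs x))

  Deg<-suc : ∀ {e f} → Deg< e f → Deg< (suc e) f
  Deg<-suc (cs , p) = cs ∷ʳ 0# , λ x → ≈-trans (p x) (≈-sym (≈-trans (horner-∷ʳ cs 0# x)
    (≈-trans (+-congˡ (zeroˡ _)) (+-identityʳ _))))

  Deg<-x : ∀ {e f} → Deg< e f → Deg< (suc e) (λ x → x ⊗ f x)
  Deg<-x (cs , p) = 0# ∷ cs , λ x → ≈-trans (*-congˡ (p x)) (≈-sym (+-identityˡ _))

  Deg<-resp : ∀ {e f g} → (∀ x → g x ≈ f x) → Deg< e f → Deg< e g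
  Deg<-resp f≈g (cs , p) = cs , λ x → ≈-trans (f≈g x) (p x)

  Deg<-linear : ∀ {e f} a → Deg< e f → Deg< (suc e) (λ x → (x ⊕ a) ⊗ f x)
  Deg<-linear a D = Deg<-resp (λ x → distribʳ _ x a) (Deg<-+ (Deg<-x D) (Deg<-suc (Deg<-scale a D)))

  Deg<-sum : ∀ {e m} (f : Fin m → Carrier → Carrier) → (∀ i → Deg< e (f i)) → Deg< e (λ x → sum (λ i → f i x))
  Deg<-sum {e} {zero}  f D = Deg<-0 e
  Deg<-sum {e} {suc m} f D = Deg<-+ (D zero) (Deg<-sum (f ∘ suc) (D ∘ suc))

  Deg<-vanish : ∀ {e f} → Deg< e f → (t : Fin e → Carrier) → (∀ {i j} → t i ≈ t j → i ≡ j) →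
    (∀ i → f (t i) ≈ 0#) → ∀ x → f x ≈ 0#
  Deg<-vanish (cs , p) t inj root x = ≈-trans (p x) (zeros cs (roots⇒zero cs t inj (λ i → ≈-trans (≈-sym (p (t i))) (root i))))
    where
    zeros : ∀ {e} (cs : Vec Carrier e) → All (_≈ 0#) cs → horner cs x ≈ 0#
    zeros [] [] = ≈-refl
    zeros (c ∷ cs) (c≈0 ∷ ps) = ≈-trans (+-cong c≈0 (*-congˡ (zeros cs ps)))
      (≈-trans (+-identityˡ _) (zeroʳ x))

  -- Polynomials in d variables whose degrees are at most d - 1, ..., 1, 0 in the
  -- successive variables.
  data V : ℕ → Set where
    scalar : Carrier → V zero
    poly   : ∀ {d} → Vec (V d) (suc d) → V (suc d)

  const : ∀ d → Carrier → V d
  const zero    c = scalar c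
  const (suc d) c = poly (const d c ∷ Vec.replicate d (const d 0#))

  infixl 6 _⊞_
  infixl 7 _⊡_

  _⊞_ : ∀ {d} → V d → V d → V d
  _⊞_ {zero}  (scalar v) (scalar w) = scalar (v ⊕ w)
  _⊞_ {suc d} (poly vs)  (poly ws)  = poly (Vec.zipWith _⊞_ vs ws)

  _⊡_ : ∀ {d} → Carrier → V d → V d
  _⊡_ {zero}  a (scalar v) = scalar (a ⊗ v)
  _⊡_ {suc d} a (poly vs)  = poly (Vec.map (a ⊡_) vs)

  hornerᵛ : ∀ {d e} → Vec (V d) e → Carrier → V d
  hornerᵛ {d} []       x = const d 0#
  hornerᵛ     (v ∷ vs) x = v ⊞ x ⊡ hornerᵛ vs x

  -- In curried form, fixing the first variable is application, and no extensionality in the points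
  -- is involved.
  Curried : ℕ → Set
  Curried zero    = Carrier
  Curried (suc d) = Carrier → Curried d

  app : ∀ d → Curried d → Point → Carrier
  app zero    f p = f
  app (suc d) f p = app d (f (p 0)) (p ∘ suc)

  curried : ∀ {d} → V d → Curried d
  curried {zero}  (scalar c)  = c
  curried {suc d} (poly vs) x = curried (hornerᵛ vs x)

  eval : ∀ {d} → V d → Point → Carrier
  eval {zero}  (scalar c) p = c
  eval {suc d} (poly vs)  p = eval (hornerᵛ vs (p 0)) (p ∘ suc)

  app-curried : ∀ {d} (v : V d) p → app d (curried v) p ≡ eval v p
  app-curried {zero}  (scalar c) p = refl
  app-curried {suc d} (poly vs)  p = app-curried (hornerᵛ vs (p 0)) (p ∘ suc)

  eval-⊞ : ∀ {d} (v w : V d) p → eval (v ⊞ w) p ≈ eval v p ⊕ eval w p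
  eval-⊡ : ∀ {d} a (v : V d) p → eval (a ⊡ v) p ≈ a ⊗ eval v p
  eval-0 : ∀ d p → eval (const d 0#) p ≈ 0#

  eval-∷ : ∀ {d e} v (vs : Vec (V d) e) x p → eval (hornerᵛ (v ∷ vs) x) p ≈ eval v p ⊕ x ⊗ eval (hornerᵛ vs x) p
  eval-∷ v vs x p = ≈-trans (eval-⊞ v (x ⊡ hornerᵛ vs x) p) (+-congˡ (eval-⊡ x (hornerᵛ vs x) p))

  eval-⊞ {zero} (scalar v) (scalar w) p = ≈-refl
  eval-⊞ {suc d} (poly v) (poly w) p = go v w
    where
    x = p 0
    go : ∀ {e} (vs ws : Vec (V d) e) → eval (hornerᵛ (Vec.zipWith _⊞_ vs ws) x) (p ∘ suc) ≈ eval (hornerᵛ vs x) (p ∘ suc) ⊕ eval (hornerᵛ ws x) (p ∘ suc)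
    go [] [] = ≈-trans (eval-0 d _) (≈-sym (≈-trans (+-cong (eval-0 d _) (eval-0 d _)) (+-identityˡ _)))
    go (v ∷ vs) (w ∷ ws) = begin
      eval (hornerᵛ (v ⊞ w ∷ Vec.zipWith _⊞_ vs ws) x) (p ∘ suc)                                       ≈⟨ eval-∷ (v ⊞ w) (Vec.zipWith _⊞_ vs ws) x _ ⟩
      eval (v ⊞ w) (p ∘ suc) ⊕ x ⊗ eval (hornerᵛ (Vec.zipWith _⊞_ vs ws) x) (p ∘ suc)                  ≈⟨ +-cong (eval-⊞ v w _) (*-congˡ (go vs ws)) ⟩
      eval v (p ∘ suc) ⊕ eval w (p ∘ suc) ⊕ x ⊗ (eval (hornerᵛ vs x) (p ∘ suc) ⊕ eval (hornerᵛ ws x) (p ∘ suc))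
        ≈⟨ solve 5 (λ c d x p q → c :+ d :+ x :* (p :+ q) := c :+ x :* p :+ (d :+ x :* q)) ≈-refl _ _ x _ _ ⟩
      eval v (p ∘ suc) ⊕ x ⊗ eval (hornerᵛ vs x) (p ∘ suc) ⊕ (eval w (p ∘ suc) ⊕ x ⊗ eval (hornerᵛ ws x) (p ∘ suc))
        ≈⟨ +-cong (eval-∷ v vs x _) (eval-∷ w ws x _) ⟨
      eval (hornerᵛ (v ∷ vs) x) (p ∘ suc) ⊕ eval (hornerᵛ (w ∷ ws) x) (p ∘ suc)                        ∎

  eval-⊡ {zero} a (scalar v) p = ≈-refl
  eval-⊡ {suc d} a (poly v) p = go v
    where
    x = p 0
    go : ∀ {e} (vs : Vec (V d) e) → eval (hornerᵛ (Vec.map (a ⊡_) vs) x) (p ∘ suc) ≈ a ⊗ eval (hornerᵛ vs x) (p ∘ suc)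
    go [] = ≈-trans (eval-0 d _) (≈-sym (≈-trans (*-congˡ (eval-0 d _)) (zeroʳ a)))
    go (v ∷ vs) = begin
      eval (hornerᵛ (a ⊡ v ∷ Vec.map (a ⊡_) vs) x) (p ∘ suc)                               ≈⟨ eval-∷ (a ⊡ v) (Vec.map (a ⊡_) vs) x _ ⟩
      eval (a ⊡ v) (p ∘ suc) ⊕ x ⊗ eval (hornerᵛ (Vec.map (a ⊡_) vs) x) (p ∘ suc)          ≈⟨ +-cong (eval-⊡ a v _) (*-congˡ (go vs)) ⟩
      a ⊗ eval v (p ∘ suc) ⊕ x ⊗ (a ⊗ eval (hornerᵛ vs x) (p ∘ suc))
        ≈⟨ solve 4 (λ a c x p → a :* c :+ x :* (a :* p) := a :* (c :+ x :* p)) ≈-refl a _ x _ ⟩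
      a ⊗ (eval v (p ∘ suc) ⊕ x ⊗ eval (hornerᵛ vs x) (p ∘ suc))                           ≈⟨ *-congˡ (eval-∷ v vs x _) ⟨
      a ⊗ eval (hornerᵛ (v ∷ vs) x) (p ∘ suc)                                              ∎

  eval-zeros : ∀ d e x p → eval (hornerᵛ (Vec.replicate e (const d 0#)) x) p ≈ 0#
  eval-zeros d zero    x p = eval-0 d p
  eval-zeros d (suc e) x p = ≈-trans (eval-∷ (const d 0#) (Vec.replicate e (const d 0#)) x p)
    (≈-trans (+-cong (eval-0 d p) (*-congˡ (eval-zeros d e x p))) (≈-trans (+-identityˡ _) (zeroʳ x)))

  eval-0 zero    p = ≈-refl
  eval-0 (suc d) p = eval-zeros d (suc d) (p 0) (p ∘ suc)

  eval-const : ∀ d c p → eval (const d c) p ≈ c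
  eval-const zero    c p = ≈-refl
  eval-const (suc d) c p = ≈-trans (eval-∷ (const d c) (Vec.replicate d (const d 0#)) (p 0) (p ∘ suc))
    (≈-trans (+-cong (eval-const d c _) (≈-trans (*-congˡ (eval-zeros d d _ _)) (zeroʳ _))) (+-identityʳ c))

  eval-horner : ∀ {d e} (vs : Vec (V d) e) x p → eval (hornerᵛ vs x) p ≈ horner (Vec.map (λ v → eval v p) vs) x
  eval-horner {d} []   x p = eval-0 d p
  eval-horner (v ∷ vs) x p = ≈-trans (eval-∷ v vs x p) (+-congˡ (*-congˡ (eval-horner vs x p)))

  Deg<-eval : ∀ {d e} (vs : Vec (V d) e) p → Deg< e (λ x → eval (hornerᵛ vs x) p)
  Deg<-eval vs p = Vec.map (λ v → eval v p) vs , λ x → eval-horner vs x p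

  sumᵛ : ∀ {d m} → (Fin m → V d) → V d
  sumᵛ {d} {zero}  v = const d 0#
  sumᵛ {d} {suc m} v = v zero ⊞ sumᵛ (v ∘ suc)

  eval-sum : ∀ {d m} (v : Fin m → V d) p → eval (sumᵛ v) p ≈ sum (λ i → eval (v i) p)
  eval-sum {d} {zero}  v p = eval-0 d p
  eval-sum {d} {suc m} v p = ≈-trans (eval-⊞ (v zero) (sumᵛ (v ∘ suc)) p) (+-congˡ (eval-sum (v ∘ suc) p))

  -- The coefficients of c + (x - t) w(x).
  newton : ∀ {d e} → Carrier → V d → Vec (V d) e → Vec (V d) (suc e)
  newton t c []       = c ∷ []
  newton t c (w ∷ ws) = (c ⊞ t ⊡ w) ∷ newton t w ws

  eval-newton : ∀ {d e} t (c : V d) (ws : Vec (V d) e) x p →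
    eval (hornerᵛ (newton t c ws) x) p ≈ eval c p ⊕ (x ⊕ t) ⊗ eval (hornerᵛ ws x) p
  eval-newton {d} t c [] x p = ≈-trans (eval-∷ c [] x p)
    (+-congˡ (≈-trans (*-congˡ (eval-0 d p)) (≈-trans (zeroʳ x) (≈-sym (≈-trans (*-congˡ (eval-0 d p)) (zeroʳ _))))))
  eval-newton t c (w ∷ ws) x p = begin
    eval (hornerᵛ (newton t c (w ∷ ws)) x) p                                ≈⟨ eval-∷ (c ⊞ t ⊡ w) (newton t w ws) x p ⟩
    eval (c ⊞ t ⊡ w) p ⊕ x ⊗ eval (hornerᵛ (newton t w ws) x) p
      ≈⟨ +-cong (≈-trans (eval-⊞ c (t ⊡ w) p) (+-congˡ (eval-⊡ t w p))) (*-congˡ (eval-newton t w ws x p)) ⟩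
    eval c p ⊕ t ⊗ eval w p ⊕ x ⊗ (eval w p ⊕ (x ⊕ t) ⊗ eval (hornerᵛ ws x) p)
      ≈⟨ solve 5 (λ c t w x h → c :+ t :* w :+ x :* (w :+ (x :+ t) :* h) := c :+ (x :+ t) :* (w :+ x :* h)) ≈-refl _ t _ x _ ⟩
    eval c p ⊕ (x ⊕ t) ⊗ (eval w p ⊕ x ⊗ eval (hornerᵛ ws x) p)             ≈⟨ +-congˡ (*-congˡ (eval-∷ w ws x p)) ⟨
    eval c p ⊕ (x ⊕ t) ⊗ eval (hornerᵛ (w ∷ ws) x) p                        ∎

  -- Newton interpolation with coefficients in `V d`: after splitting off the value at `t zero`, the
  -- divided differences are interpolated at the remaining nodes.
  interpolate : ∀ {d e} (t : Fin e → Carrier) → (∀ {i j} → t i ≈ t j → i ≡ j) → (v : Fin e → V d) →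
    ∃ λ (vs : Vec (V d) e) → ∀ i p → eval (hornerᵛ vs (t i)) p ≈ eval (v i) p
  interpolate {e = zero} t inj v = [] , λ ()
  interpolate {e = suc e} t inj v = newton (t zero) (v zero) ws , at
    where
    δ : Fin e → Carrier
    δ i = t (suc i) ⊕ t zero
    δ≉0 : ∀ i → ¬ δ i ≈ 0#
    δ≉0 i eq with inj (⊕≈0⇒≈ eq)
    ... | ()
    rest = interpolate (t ∘ suc) (λ eq → Fin.suc-injective (inj eq)) (λ i → inv (δ i) ⊡ (v (suc i) ⊞ v zero))
    ws = proj₁ rest
    at : ∀ i p → eval (hornerᵛ (newton (t zero) (v zero) ws) (t i)) p ≈ eval (v i) p
    at zero p = begin
      eval (hornerᵛ (newton (t zero) (v zero) ws) (t zero)) p               ≈⟨ eval-newton (t zero) (v zero) ws (t zero) p ⟩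
      eval (v zero) p ⊕ (t zero ⊕ t zero) ⊗ eval (hornerᵛ ws (t zero)) p    ≈⟨ solve 3 (λ a b c → a :+ (b :+ b) :* c := a) ≈-refl _ _ _ ⟩
      eval (v zero) p                                                       ∎
    at (suc i) p = begin
      eval (hornerᵛ (newton (t zero) (v zero) ws) (t (suc i))) p            ≈⟨ eval-newton (t zero) (v zero) ws (t (suc i)) p ⟩
      eval (v zero) p ⊕ δ i ⊗ eval (hornerᵛ ws (t (suc i))) p               ≈⟨ +-congˡ (*-congˡ (≈-trans (proj₂ rest i p) (≈-trans (eval-⊡ (inv (δ i)) (v (suc i) ⊞ v zero) p) (*-congˡ (eval-⊞ (v (suc i)) (v zero) p))))) ⟩
      eval (v zero) p ⊕ δ i ⊗ (inv (δ i) ⊗ (eval (v (suc i)) p ⊕ eval (v zero) p)) ≈⟨ +-congˡ (≈-trans (≈-sym (*-assoc _ _ _)) (≈-trans (*-congʳ (⊗-inv (δ≉0 i))) (*-identityˡ _))) ⟩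
      eval (v zero) p ⊕ (eval (v (suc i)) p ⊕ eval (v zero) p)              ≈⟨ solve 2 (λ a b → a :+ (b :+ a) := b) ≈-refl _ _ ⟩
      eval (v (suc i)) p                                                    ∎

  -- Functions of d variables that are polynomial of degree at most d, ..., 1 in
  -- the successive variables separately.
  W : ∀ d → Curried d → Set
  W zero    f = Unit.⊤
  W (suc d) f = (∀ x → W d (f x)) × (∀ p → Deg< (suc (suc d)) (λ x → app d (f x) p))

  W-curried : ∀ {d} (v : V d) → W d (curried v)
  W-curried {zero}  (scalar c) = _
  W-curried {suc d} (poly v) = (λ x → W-curried (hornerᵛ v x)) ,
    λ p → Deg<-resp (λ x → reflexive (app-curried (hornerᵛ v x) p)) (Deg<-suc (Deg<-eval v p))

  W-head : ∀ {d} (v : Vec (V d) (suc d)) → W (suc d) (λ x → curried (x ⊡ hornerᵛ v x))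
  W-head v = (λ x → W-curried (x ⊡ hornerᵛ v x)) ,
    λ p → Deg<-resp (λ x → ≈-trans (reflexive (app-curried (x ⊡ hornerᵛ v x) p)) (eval-⊡ x (hornerᵛ v x) p)) (Deg<-x (Deg<-eval v p))

  Π : ℕ → Point → Point → Carrier
  Π zero    p a = 1#
  Π (suc d) p a = (p 0 ⊕ a 0) ⊗ Π d (p ∘ suc) (a ∘ suc)

  -- Restricting the first variable to the node a i 0 kills the i-th product, so
  -- the induction hypothesis applies to the remaining rows; the coefficients
  -- found at the various nodes are then interpolated.
  decompose : ∀ {d} (a : Fin (suc d) → Point) → (∀ k {i j} → a i k ≈ a j k → i ≡ j) →
    (f : Curried d) → W d f → ∃ λ (g : Fin (suc d) → V d) → ∀ p → app d f p ≈ sum (λ i → Π d p (a i) ⊗ eval (g i) p)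
  decompose {zero} a inj f _ = (λ _ → scalar f) , λ p → ≈-sym (≈-trans (+-identityʳ _) (*-identityˡ f))
  decompose {suc d} a inj f (Wf , Df) = poly ∘ g , λ p → ⊕≈0⇒≈ (vanish (p ∘ suc) (p 0))
    where
    node : Fin (suc (suc d)) → Carrier
    node i = a i 0

    IH : ∀ i → ∃ λ (h : Fin (suc d) → V d) →
      ∀ p → app d (f (node i)) p ≈ sum (λ k → Π d p (a (punchIn i k) ∘ suc) ⊗ eval (h k) p)
    IH i = decompose (λ k → a (punchIn i k) ∘ suc) (λ k eq → punchIn-injective i _ _ (inj (suc k) eq)) (f (node i)) (Wf (node i))

    h : Fin (suc (suc d)) → Fin (suc d) → V d
    h i = proj₁ (IH i)

    -- At the node of `i` the product for `i′` carries the factor `node i ⊕ node i′`; dividing by it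
    -- gives the value that `g i′` must take there. Its value at its own node is free, so `suc d`
    -- coefficients suffice.
    value : ∀ i i′ → i ≢ i′ → V d
    value i i′ i≢i′ = inv (node i ⊕ node i′) ⊡ h i (punchOut i≢i′)

    interpolant : ∀ i′ → ∃ λ (vs : Vec (V d) (suc d)) → ∀ k p →
      eval (hornerᵛ vs (node (punchIn i′ k))) p ≈ eval (value (punchIn i′ k) i′ (punchInᵢ≢i i′ k)) p
    interpolant i′ = interpolate (λ k → node (punchIn i′ k)) (λ eq → punchIn-injective i′ _ _ (inj 0 eq))
      (λ k → value (punchIn i′ k) i′ (punchInᵢ≢i i′ k))

    g : Fin (suc (suc d)) → Vec (V d) (suc d)
    g i′ = proj₁ (interpolant i′)

    g-node : ∀ i i′ (i≢i′ : i ≢ i′) p → eval (hornerᵛ (g i′) (node i)) p ≈ eval (value i i′ i≢i′) p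
    g-node i i′ i≢i′ p = go i (punchOut (i≢i′ ∘ ≡.sym)) (punchIn-punchOut (i≢i′ ∘ ≡.sym)) i≢i′
      where
      go : ∀ i k → punchIn i′ k ≡ i → (i≢i′ : i ≢ i′) → eval (hornerᵛ (g i′) (node i)) p ≈ eval (value i i′ i≢i′) p
      go i k refl i≢i′ = ≈-trans (proj₂ (interpolant i′) k p)
        (reflexive (cong (λ j → eval (inv (node i ⊕ node i′) ⊡ h i j) p) (punchOut-cong i refl)))

    term : Point → Carrier → Fin (suc (suc d)) → Carrier
    term p x i′ = (x ⊕ node i′) ⊗ Π d p (a i′ ∘ suc) ⊗ eval (hornerᵛ (g i′) x) p

    term-self : ∀ p i → term p (node i) i ≈ 0#
    term-self p i = solve 3 (λ x y z → (x :+ x) :* y :* z := con false) ≈-refl _ _ _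

    term-other : ∀ p i k → term p (node i) (punchIn i k) ≈ Π d p (a (punchIn i k) ∘ suc) ⊗ eval (h i k) p
    term-other p i k = begin
      δ ⊗ P ⊗ eval (hornerᵛ (g i′) (node i)) p          ≈⟨ *-congˡ (≈-trans (g-node i i′ ne p) (eval-⊡ (inv δ) (h i (punchOut ne)) p)) ⟩
      δ ⊗ P ⊗ (inv δ ⊗ eval (h i (punchOut ne)) p)      ≈⟨ solve 4 (λ a b c e → a :* b :* (c :* e) := (a :* c) :* (b :* e)) ≈-refl _ _ _ _ ⟩
      (δ ⊗ inv δ) ⊗ (P ⊗ eval (h i (punchOut ne)) p)    ≈⟨ *-congʳ (⊗-inv (λ eq → ne (inj 0 (⊕≈0⇒≈ eq)))) ⟩
      1# ⊗ (P ⊗ eval (h i (punchOut ne)) p)             ≈⟨ *-identityˡ _ ⟩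
      P ⊗ eval (h i (punchOut ne)) p                    ≡⟨ cong (λ j → P ⊗ eval (h i j) p) (≡.trans (punchOut-cong i refl) (punchOut-punchIn i)) ⟩
      P ⊗ eval (h i k) p                                ∎
      where
      i′ = punchIn i k
      ne : i ≢ i′
      ne = punchInᵢ≢i i k ∘ ≡.sym
      δ = node i ⊕ node i′
      P = Π d p (a i′ ∘ suc)

    -- In the first variable this has degree at most `suc d`, and it vanishes at all `suc (suc d)`
    -- nodes.
    vanish : ∀ p x → app d (f x) p ⊕ sum (term p x) ≈ 0#
    vanish p = Deg<-vanish
      (Deg<-+ (Df p) (Deg<-sum (λ i′ x → term p x i′) (λ i′ → Deg<-resp (λ x → *-assoc _ _ _) (Deg<-linear (node i′) (Deg<-scale _ (Deg<-eval (g i′) p))))))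
      node (inj 0) (λ i → ≈⇒⊕≈0 (begin
        app d (f (node i)) p                                                           ≈⟨ proj₂ (IH i) p ⟩
        sum (λ k → Π d p (a (punchIn i k) ∘ suc) ⊗ eval (h i k) p)                   ≈⟨ sum-cong-≋ (λ k → term-other p i k) ⟨
        sum (λ k → term p (node i) (punchIn i k))                                    ≈⟨ +-identityˡ _ ⟨
        0# ⊕ sum (λ k → term p (node i) (punchIn i k))                               ≈⟨ +-congʳ (term-self p i) ⟨
        term p (node i) i ⊕ sum (λ k → term p (node i) (punchIn i k))                ≈⟨ sum-remove {i = i} (term p (node i)) ⟨
        sum (term p (node i))                                                        ∎))

  module Solutions {d N} (a : Fin (suc (suc d)) → Point) (a-inj : ∀ k {i j} → a i k ≈ a j k → i ≡ j)
    (p : Fin N → Point) (ρ : Fin (suc (suc d)) → Carrier)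
    (ratio : ∀ i l → Π (suc d) (p l) (a i) ≈ ρ i ⊗ Π (suc d) (p l) (a zero))
    (nonzero : ∀ l → ¬ Π (suc d) (p l) (a zero) ≈ 0#) where

    π u head : Fin N → Carrier
    π l    = Π (suc d) (p l) (a zero)
    u l    = inv (π l)
    head l = p l 0

    πu : ∀ l → π l ⊗ u l ≈ 1#
    πu l = ⊗-inv (nonzero l)

    InV : (Fin N → Carrier) → Set
    InV f = ∃ λ (v : V (suc d)) → ∀ l → f l ≈ eval v (p l)

    InV-resp : ∀ {f g} → (∀ l → g l ≈ f l) → InV f → InV g
    InV-resp g≈f (v , eq) = v , λ l → ≈-trans (g≈f l) (eq l)

    InV-+ : ∀ {f g} → InV f → InV g → InV (λ l → f l ⊕ g l)
    InV-+ (v , eq) (w , eq′) = v ⊞ w , λ l → ≈-trans (+-cong (eq l) (eq′ l)) (≈-sym (eval-⊞ v w (p l)))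

    common-factor : ∀ (h : Fin (suc (suc d)) → Carrier) l →
      sum (λ i → Π (suc d) (p l) (a i) ⊗ h i) ≈ π l ⊗ sum (λ i → ρ i ⊗ h i)
    common-factor h l = ≈-trans (sum-cong-≋ (λ i → ≈-trans (*-congʳ (ratio i l)) (swap (ρ i) (π l) (h i))))
      (≈-sym (*-distribˡ-sum (π l) (λ i → ρ i ⊗ h i)))
      where
      swap : ∀ r x e → r ⊗ x ⊗ e ≈ x ⊗ (r ⊗ e)
      swap = solve 3 (λ r x e → r :* x :* e := x :* (r :* e)) ≈-refl

    u-cancel : ∀ l x → u l ⊗ (π l ⊗ x) ≈ x
    u-cancel l x = ≈-trans (swap (u l) (π l) x) (≈-trans (*-congʳ (πu l)) (*-identityˡ x))
      where
      swap : ∀ x y z → x ⊗ (y ⊗ z) ≈ y ⊗ x ⊗ z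
      swap = solve 3 (λ x y z → x :* (y :* z) := y :* x :* z) ≈-refl

    -- On the solution set each product is the multiple `ρ i` of `π`, so the sum given by
    -- `decompose` becomes `π` times an element of `V`. The degrees of `W` have dropped to those of
    -- `V` at the cost of a factor `u`.
    W⇒InV : ∀ f → W (suc d) f → InV (λ l → u l ⊗ app (suc d) f (p l))
    W⇒InV f Wf = collect (decompose a a-inj f Wf)
      where
      collect : (∃ λ (g : Fin (suc (suc d)) → V (suc d)) →
          ∀ q → app (suc d) f q ≈ sum (λ i → Π (suc d) q (a i) ⊗ eval (g i) q)) →
        InV (λ l → u l ⊗ app (suc d) f (p l))
      collect (g , eq) = sumᵛ (λ i → ρ i ⊡ g i) , λ l →
        ≈-trans (*-congˡ (≈-trans (eq (p l)) (common-factor (λ i → eval (g i) (p l)) l)))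
        (≈-trans (u-cancel l (sum (λ i → ρ i ⊗ eval (g i) (p l))))
        (≈-sym (≈-trans (eval-sum (λ i → ρ i ⊡ g i) (p l)) (sum-cong-≋ (λ i → eval-⊡ (ρ i) (g i) (p l))))))

    -- `V` is contained in `W`, so multiplication by `u` maps the restrictions of `V` into
    -- themselves.
    InV-u : ∀ {f} → InV f → InV (λ l → u l ⊗ f l)
    InV-u (v , eq) = InV-resp (λ l → *-congˡ (≈-trans (eq l) (reflexive (≡.sym (app-curried v (p l))))))
      (W⇒InV (curried v) (W-curried v))

    InV-u↑ : ∀ k {f} → InV f → InV (λ l → u l ↑ k ⊗ f l)
    InV-u↑ zero    F = InV-resp (λ l → *-identityˡ _) F
    InV-u↑ (suc k) F = InV-resp (λ l → *-assoc _ _ _) (InV-u (InV-u↑ k F))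

    -- The first variable times an element of `V` lies in `W`, which costs a factor `u`. Multiplying
    -- by `u` a further `r` times removes it, because `u ↑ suc r` is 1.
    InV-head : ∀ {f} → InV f → InV (λ l → head l ⊗ f l)
    InV-head {f} (poly v , eq) = InV-resp cancel (InV-u↑ r (W⇒InV (λ x → curried (x ⊡ hornerᵛ v x)) (W-head v)))
      where
      uʳ⁺¹≈1 : ∀ l → u l ⊗ u l ↑ r ≈ 1#
      uʳ⁺¹≈1 l = ⊗-inv λ u≈0 → 1≉0 (≈-trans (≈-sym (πu l)) (≈-trans (*-congˡ u≈0) (zeroʳ _)))
      regroup : ∀ x y z → x ⊗ y ⊗ z ≈ y ⊗ (x ⊗ z)
      regroup = solve 3 (λ x y z → x :* y :* z := y :* (x :* z)) ≈-refl
      step : ∀ l → head l ⊗ f l ≈ app d (curried (head l ⊡ hornerᵛ v (head l))) (p l ∘ suc)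
      step l = ≈-trans (*-congˡ (eq l)) (≈-trans (≈-sym (eval-⊡ (head l) (hornerᵛ v (head l)) (p l ∘ suc)))
        (reflexive (≡.sym (app-curried (head l ⊡ hornerᵛ v (head l)) (p l ∘ suc)))))
      cancel : ∀ l → head l ⊗ f l ≈ u l ↑ r ⊗ (u l ⊗ app d (curried (head l ⊡ hornerᵛ v (head l))) (p l ∘ suc))
      cancel l = ≈-trans (step l) (≈-trans (≈-sym (*-identityˡ _)) (≈-trans (*-congʳ (≈-sym (uʳ⁺¹≈1 l))) (regroup _ _ _)))

    InV-horner : ∀ {e} (cs : Vec (V zero) e) → InV (λ l → eval (hornerᵛ cs (head l)) (p l))
    InV-horner []       = const (suc d) 0# , λ l → ≈-sym (eval-0 (suc d) (p l))
    InV-horner (scalar c ∷ cs) = InV-resp (λ l → eval-∷ (scalar c) cs (head l) (p l))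
      (InV-+ (const (suc d) c , λ l → ≈-sym (eval-const (suc d) c (p l))) (InV-head (InV-horner cs)))

    -- As the heads are distinct, every function on the solutions is a polynomial in the head,
    -- possibly of large degree; closure under multiplication by the head reaches all of these.
    InV-all : (∀ {l m} → head l ≈ head m → l ≡ m) → ∀ f → InV f
    InV-all inj f with interpolate {zero} head inj (λ l → scalar (f l))
    ... | cs , eq = InV-resp (λ l → ≈-sym (eq l (p l))) (InV-horner cs)

  module Count {Q} (to : Fin Q → Carrier) (to-inj : ∀ {i j} → to i ≈ to j → i ≡ j)
    (code : Carrier → Fin Q) (code-inj : ∀ {x y} → code x ≡ code y → x ≈ y) (1<Q : 1 ℕ.< Q) where

    -- An element of `V d` has `d !` scalar coefficients: this is the origin of the factorial.
    card : ℕ → ℕ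
    card zero    = Q
    card (suc d) = card d ℕ.^ suc d

    card≡ : ∀ d → card d ≡ Q ℕ.^ (d !)
    card≡ zero    = ≡.sym (ℕ.*-identityʳ Q)
    card≡ (suc d) = ≡.trans (cong (ℕ._^ suc d) (card≡ d)) (≡.trans (ℕ.^-*-assoc Q (d !) (suc d)) (cong (Q ℕ.^_) (ℕ.*-comm (d !) (suc d))))

    enc : ∀ {d} → V d → Fin (card d)
    enc (scalar c) = code c
    enc (poly vs)  = funToFin (λ i → enc (Vec.lookup vs i))

    enc-injective : ∀ {d} (v w : V d) → enc v ≡ enc w → ∀ p → eval v p ≈ eval w p
    enc-injective (scalar c) (scalar c′) eq p = code-inj eq
    enc-injective (poly vs) (poly ws) eq p = go vs ws (λ i → enc-injective (Vec.lookup vs i) (Vec.lookup ws i)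
        (≡.trans (≡.sym (finToFun-funToFin (λ i → enc (Vec.lookup vs i)) i))
          (≡.trans (cong (λ c → finToFun c i) eq) (finToFun-funToFin (λ i → enc (Vec.lookup ws i)) i))))
      where
      go : ∀ {d e} (vs ws : Vec (V d) e) → (∀ i p → eval (Vec.lookup vs i) p ≈ eval (Vec.lookup ws i) p) →
        ∀ {x p} → eval (hornerᵛ vs x) p ≈ eval (hornerᵛ ws x) p
      go []       []       h = ≈-refl
      go (v ∷ vs) (w ∷ ws) h = ≈-trans (eval-∷ v vs _ _) (≈-trans
        (+-cong (h zero _) (*-congˡ (go vs ws (h ∘ suc)))) (≈-sym (eval-∷ w ws _ _)))

    -- The Q ^ N functions on the solution set embed into the Q ^ (d + 1)! elements of V.
    solutions≤! : ∀ {d N} (a : Fin (suc (suc d)) → Point) → (∀ k {i j} → a i k ≈ a j k → i ≡ j) →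
      (p : Fin N → Point) → (∀ {l m} → p l 0 ≈ p m 0 → l ≡ m) → (ρ : Fin (suc (suc d)) → Carrier) →
      (∀ i l → Π (suc d) (p l) (a i) ≈ ρ i ⊗ Π (suc d) (p l) (a zero)) →
      (∀ l → ¬ Π (suc d) (p l) (a zero) ≈ 0#) → N ℕ.≤ suc d !
    solutions≤! {d} {N} a a-inj p p-inj ρ ratio nonzero = ℕ.≮⇒≥ λ !<N →
      ℕ.<⇒≱ (ℕ.^-monoʳ-< Q 1<Q !<N) (≡.subst (Q ℕ.^ N ℕ.≤_) (card≡ (suc d)) (injective⇒≤ inj))
      where
      open Solutions a a-inj p ρ ratio nonzero
      values : Fin (Q ℕ.^ N) → Fin N → Carrier
      values m l = to (finToFun m l)
      extend : ∀ m → InV (values m)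
      extend m = InV-all p-inj (values m)
      inj : ∀ {m m′} → enc (proj₁ (extend m)) ≡ enc (proj₁ (extend m′)) → m ≡ m′
      inj {m} {m′} eq = finToFun-injective {Q} {N} (λ l → to-inj (≈-trans (proj₂ (extend m) l)
        (≈-trans (enc-injective (proj₁ (extend m)) (proj₁ (extend m′)) eq (p l)) (≈-sym (proj₂ (extend m′) l)))))

-- Finite fields of order 2^m

Seq : Set
Seq = ℕ → Bool

private
  xor-medial : ∀ a b c d → (a xor b) xor (c xor d) ≡ (a xor c) xor (b xor d)
  xor-medial a b c d = trans (xor-assoc a b (c xor d)) (trans (cong (a xor_)
    (trans (sym (xor-assoc b c d)) (trans (cong (_xor d) (xor-comm b c)) (xor-assoc c b d)))) (sym (xor-assoc a c (b xor d))))

-- A list of exponents stands for the sum of the corresponding powers of Y over 𝔽₂,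
-- and pairs with a sequence by Yⁱ ↦ φ i.
pair : List ℕ → Seq → Bool
pair []      φ = false
pair (i ∷ a) φ = φ i xor pair a φ

infixr 7 _▹_

_▹_ : List ℕ → Seq → Seq
(a ▹ φ) j = pair a (λ i → φ (j + i))

infixl 7 _*ᴸ_

_*ᴸ_ : List ℕ → List ℕ → List ℕ
[]      *ᴸ b = []
(i ∷ a) *ᴸ b = map (i ℕ.+_) b ++ a *ᴸ b

pair-cong : ∀ a {φ χ} → φ ≗ χ → pair a φ ≡ pair a χ
pair-cong []      eq = refl
pair-cong (i ∷ a) eq = cong₂ _xor_ (eq i) (pair-cong a eq)

pair-++ : ∀ a b φ → pair (a ++ b) φ ≡ pair a φ xor pair b φ
pair-++ []      b φ = refl
pair-++ (i ∷ a) b φ = trans (cong (φ i xor_) (pair-++ a b φ)) (sym (xor-assoc (φ i) (pair a φ) (pair b φ)))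

pair-map : ∀ i b φ → pair (map (i ℕ.+_) b) φ ≡ pair b (λ j → φ (i + j))
pair-map i []      φ = refl
pair-map i (j ∷ b) φ = cong (φ (i + j) xor_) (pair-map i b φ)

pair-* : ∀ a b φ → pair (a *ᴸ b) φ ≡ pair a (λ i → pair b (λ j → φ (i + j)))
pair-* []      b φ = refl
pair-* (i ∷ a) b φ = trans (pair-++ (map (i ℕ.+_) b) (a *ᴸ b) φ) (cong₂ _xor_ (pair-map i b φ) (pair-* a b φ))

pair-xor : ∀ a φ χ → pair a (λ i → φ i xor χ i) ≡ pair a φ xor pair a χ
pair-xor []      φ χ = refl
pair-xor (i ∷ a) φ χ = trans (cong ((φ i xor χ i) xor_) (pair-xor a φ χ)) (xor-medial (φ i) (χ i) (pair a φ) (pair a χ))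

pair-false : ∀ a → pair a (λ _ → false) ≡ false
pair-false []      = refl
pair-false (i ∷ a) = pair-false a

pair-comm : ∀ a b (F : ℕ → ℕ → Bool) → pair a (λ i → pair b (F i)) ≡ pair b (λ j → pair a (λ i → F i j))
pair-comm []      b F = sym (pair-false b)
pair-comm (i ∷ a) b F = trans (cong (pair b (F i) xor_) (pair-comm a b F)) (sym (pair-xor b (F i) (λ j → pair a (λ i → F i j))))

▹-cong : ∀ a {φ χ} → φ ≗ χ → a ▹ φ ≗ a ▹ χ
▹-cong a eq j = pair-cong a (λ i → eq (j + i))

▹-++ : ∀ a b φ j → ((a ++ b) ▹ φ) j ≡ (a ▹ φ) j xor (b ▹ φ) j
▹-++ a b φ j = pair-++ a b (λ i → φ (j + i))

▹-* : ∀ a b φ → (a *ᴸ b) ▹ φ ≗ a ▹ b ▹ φ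
▹-* a b φ j = trans (pair-* a b (λ i → φ (j + i))) (pair-cong a (λ i → pair-cong b (λ k → cong φ (sym (ℕ.+-assoc j i k)))))

▹-comm : ∀ a b φ → a ▹ b ▹ φ ≗ b ▹ a ▹ φ
▹-comm a b φ j = trans (pair-cong a (λ i → pair-cong b (λ k → cong φ (ℕ.+-assoc j i k))))
  (trans (pair-comm a b (λ i k → φ (j + (i + k))))
  (pair-cong b (λ k → pair-cong a (λ i → cong φ (trans (cong (j ℕ.+_) (ℕ.+-comm i k)) (sym (ℕ.+-assoc j k i)))))))

▹-xor : ∀ a φ χ j → (a ▹ (λ i → φ i xor χ i)) j ≡ (a ▹ φ) j xor (a ▹ χ) j
▹-xor a φ χ j = pair-xor a _ _

▹-1 : ∀ φ → (0 ∷ []) ▹ φ ≗ φ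
▹-1 φ j = trans (xor-identityʳ _) (cong φ (ℕ.+-identityʳ j))

-- 𝔽₂[Y] modulo the annihilator of ψ, where Y acts on sequences as the shift.
seqRing : Seq → CommutativeRing 0ℓ 0ℓ
seqRing ψ = record
  { Carrier = List ℕ ; _≈_ = λ a b → a ▹ ψ ≗ b ▹ ψ ; _+_ = _++_ ; _*_ = _*ᴸ_ ; -_ = id ; 0# = [] ; 1# = 0 ∷ []
  ; isCommutativeRing = record
    { isRing = record
      { +-isAbelianGroup = record
        { isGroup = record
          { isMonoid = record
            { isSemigroup = record
              { isMagma = record
                { isEquivalence = record { refl = λ _ → refl ; sym = λ p j → sym (p j) ; trans = λ p q j → trans (p j) (q j) }
                ; ∙-cong = λ {a} {b} {c} {d} p q j → trans (▹-++ a c ψ j) (trans (cong₂ _xor_ (p j) (q j)) (sym (▹-++ b d ψ j))) }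
              ; assoc = λ a b c j → trans (▹-++ (a ++ b) c ψ j) (trans (cong (_xor (c ▹ ψ) j) (▹-++ a b ψ j))
                  (trans (xor-assoc ((a ▹ ψ) j) _ _) (sym (trans (▹-++ a (b ++ c) ψ j) (cong ((a ▹ ψ) j xor_) (▹-++ b c ψ j)))))) }
            ; identity = (λ _ _ → refl) , λ a j → trans (▹-++ a [] ψ j) (xor-identityʳ _) }
          ; inverse = self-inverse , self-inverse
          ; ⁻¹-cong = id }
        ; comm = λ a b j → trans (▹-++ a b ψ j) (trans (xor-comm ((a ▹ ψ) j) _) (sym (▹-++ b a ψ j))) }
      ; *-cong = λ {a} {b} {c} {d} p q → chain (▹-* a c ψ) (chain (▹-cong a q) (chain (▹-comm a d ψ) (chain (▹-cong d p)
          (chain (▹-comm d b ψ) (flip (▹-* b d ψ))))))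
      ; *-assoc = λ a b c → chain (▹-* (a *ᴸ b) c ψ) (chain (▹-* a b (c ▹ ψ)) (chain (▹-cong a (flip (▹-* b c ψ))) (flip (▹-* a (b *ᴸ c) ψ))))
      ; *-identity = (λ a → chain (▹-* (0 ∷ []) a ψ) (▹-1 (a ▹ ψ))) , λ a → chain (▹-* a (0 ∷ []) ψ) (▹-cong a (▹-1 ψ))
      ; distrib = distribˡ , λ a b c → chain (*-comm (b ++ c) a) (chain (distribˡ a b c)
          λ j → trans (▹-++ (a *ᴸ b) (a *ᴸ c) ψ j) (trans (cong₂ _xor_ (*-comm a b j) (*-comm a c j)) (sym (▹-++ (b *ᴸ a) (c *ᴸ a) ψ j)))) }
    ; *-comm = *-comm } }
  where
  chain : ∀ {φ χ ω : Seq} → φ ≗ χ → χ ≗ ω → φ ≗ ω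
  chain p q j = trans (p j) (q j)
  flip : ∀ {φ χ : Seq} → φ ≗ χ → χ ≗ φ
  flip p j = sym (p j)
  self-inverse : ∀ a → (a ++ a) ▹ ψ ≗ [] ▹ ψ
  self-inverse a j = trans (▹-++ a a ψ j) (xor-same ((a ▹ ψ) j))
  *-comm : ∀ a b → (a *ᴸ b) ▹ ψ ≗ (b *ᴸ a) ▹ ψ
  *-comm a b = chain (▹-* a b ψ) (chain (▹-comm a b ψ) (flip (▹-* b a ψ)))
  distribˡ : ∀ a b c → (a *ᴸ (b ++ c)) ▹ ψ ≗ (a *ᴸ b ++ a *ᴸ c) ▹ ψ
  distribˡ a b c = chain (▹-* a (b ++ c) ψ) (chain (▹-cong a (▹-++ b c ψ))
    λ j → trans (▹-xor a (b ▹ ψ) (c ▹ ψ) j) (sym (trans (▹-++ (a *ᴸ b) (a *ᴸ c) ψ j) (cong₂ _xor_ (▹-* a b ψ j) (▹-* a c ψ j)))))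

seqRing-double : ∀ ψ a → (a ++ a) ▹ ψ ≗ [] ▹ ψ
seqRing-double ψ = CommutativeRing.-‿inverseʳ (seqRing ψ)

powᴸ : List ℕ → ℕ → List ℕ
powᴸ a zero    = 0 ∷ []
powᴸ a (suc n) = a *ᴸ powᴸ a n

↑≡powᴸ : ∀ ψ a n → CharTwo._↑_ (seqRing ψ) (seqRing-double ψ) a n ≡ powᴸ a n
↑≡powᴸ ψ a zero    = refl
↑≡powᴸ ψ a (suc n) = cong (a *ᴸ_) (↑≡powᴸ ψ a n)

powᴸ-monomial : ∀ i n → powᴸ (i ∷ []) n ≡ n ℕ.* i ∷ []
powᴸ-monomial i zero    = refl
powᴸ-monomial i (suc n) = cong ((i ∷ []) *ᴸ_) (powᴸ-monomial i n)

Zero : Seq → Set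
Zero φ = ∀ j → φ j ≡ false

▹-zero : ∀ a {φ} → Zero φ → Zero (a ▹ φ)
▹-zero a φ≗0 j = trans (pair-cong a (λ i → φ≗0 (j + i))) (pair-false a)

-- Over 𝔽₂, adding a power of `Y` to a sum of distinct powers inserts or removes it. This keeps all
-- sums within a finite list of representatives.
toggle : ∀ xs x r → x ∈ xs → r ∈ sublists xs → ∃ λ r′ → r′ ∈ sublists xs × ∀ φ → pair (x ∷ r) φ ≡ pair r′ φ
toggle (y ∷ xs) x r x∈ r∈ with ∈-++⁻ (map (y ∷_) (sublists xs)) r∈
toggle (y ∷ xs) .y r (here refl) r∈ | inj₁ p with ∈-map⁻ (y ∷_) p
... | r₀ , r₀∈ , refl = r₀ , ∈-++⁺ʳ _ r₀∈ , λ φ → trans (sym (xor-assoc (φ y) (φ y) (pair r₀ φ))) (cong (_xor pair r₀ φ) (xor-same (φ y)))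
toggle (y ∷ xs) .y r (here refl) r∈ | inj₂ p = y ∷ r , ∈-++⁺ˡ (∈-map⁺ (y ∷_) p) , λ φ → refl
toggle (y ∷ xs) x r (there x∈) r∈ | inj₁ p with ∈-map⁻ (y ∷_) p
... | r₀ , r₀∈ , refl with toggle xs x r₀ x∈ r₀∈
...   | r′ , r′∈ , eq = y ∷ r′ , ∈-++⁺ˡ (∈-map⁺ (y ∷_) r′∈) , λ φ →
  trans (sym (xor-assoc (φ x) (φ y) (pair r₀ φ))) (trans (cong (_xor pair r₀ φ) (xor-comm (φ x) (φ y)))
    (trans (xor-assoc (φ y) (φ x) (pair r₀ φ)) (cong (φ y xor_) (eq φ))))
toggle (y ∷ xs) x r (there x∈) r∈ | inj₂ p with toggle xs x r x∈ p
... | r′ , r′∈ , eq = r′ , ∈-++⁺ʳ _ r′∈ , eq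

-- gap j = Y^(2^j) + Y. As gapProduct (m - 1) is monic of degree 2^m - 2, it does not vanish
-- modulo Y^(2^m - 1) - 1; in a residue field where it is invertible, Y has degree m over 𝔽₂.
gap : ℕ → List ℕ
gap j = 2 ℕ.^ j ∷ 1 ∷ []

gapProduct : ℕ → List ℕ
gapProduct zero    = 0 ∷ []
gapProduct (suc J) = gap (suc J) *ᴸ gapProduct J

gapDegree : ℕ → ℕ
gapDegree zero    = 0
gapDegree (suc J) = 2 ℕ.^ suc J + gapDegree J

2+gapDegree≡2^ : ∀ J → 2 + gapDegree J ≡ 2 ℕ.^ suc J
2+gapDegree≡2^ zero    = refl
2+gapDegree≡2^ (suc J) = trans (trans (sym (ℕ.+-assoc 2 (2 ℕ.^ suc J) (gapDegree J))) (trans (cong (_+ gapDegree J) (ℕ.+-comm 2 (2 ℕ.^ suc J)))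
  (ℕ.+-assoc (2 ℕ.^ suc J) 2 (gapDegree J)))) (cong (2 ℕ.^ suc J ℕ.+_) (trans (2+gapDegree≡2^ J) (sym (ℕ.+-identityʳ _))))

-- The product is monic, and a sequence that vanishes below its degree sees only the leading term.
pair-gapProduct : ∀ J φ → (∀ i → i < gapDegree J → φ i ≡ false) → pair (gapProduct J) φ ≡ φ (gapDegree J)
pair-gapProduct zero    φ low = xor-identityʳ (φ 0)
pair-gapProduct (suc J) φ low = trans (pair-* (gap (suc J)) (gapProduct J) φ)
  (trans (cong₂ _xor_
    (pair-gapProduct J (λ i → φ (2 ℕ.^ suc J + i)) (λ i i<D → low _ (ℕ.+-monoʳ-< (2 ℕ.^ suc J) i<D)))
    (trans (xor-identityʳ _) (trans (pair-gapProduct J (λ i → φ (1 + i)) (λ i i<D → low _ (ℕ.≤-<-trans i<D D<)))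
      (low _ 1+D<))))
    (xor-identityʳ _))
  where
  1+D< : 1 + gapDegree J < gapDegree (suc J)
  1+D< = ℕ.≤-trans (ℕ.≤-reflexive (2+gapDegree≡2^ J)) (ℕ.m≤m+n _ (gapDegree J))
  D< : gapDegree J < gapDegree (suc J)
  D< = ℕ.<-trans (ℕ.n<1+n _) 1+D<

-- Residue fields of 𝔽₂[Y] modulo Y^(2^m - 1) - 1

module _ (m r : ℕ) (2^m : 2 ℕ.^ m ≡ suc (suc r)) where

  Periodic : Seq → Set
  Periodic φ = ∀ i → φ (suc r + i) ≡ φ i

  ▹-periodic : ∀ a {φ} → Periodic φ → Periodic (a ▹ φ)
  ▹-periodic a {φ} per j = pair-cong a (λ i → trans (cong φ (ℕ.+-assoc (suc r) j i)) (per (j + i)))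

  periodic-* : ∀ {φ} → Periodic φ → ∀ k i → φ (k ℕ.* suc r + i) ≡ φ i
  periodic-*       per zero    i = refl
  periodic-* {φ} per (suc k) i = trans (cong φ (ℕ.+-assoc (suc r) (k ℕ.* suc r) i)) (trans (per _) (periodic-* per k i))

  periodic-% : ∀ {φ} → Periodic φ → ∀ i → φ (i % suc r) ≡ φ i
  periodic-% {φ} per i = sym (trans (cong φ (trans (m≡m%n+[m/n]*n i (suc r)) (ℕ.+-comm (i % suc r) _))) (periodic-* {φ} per (i ℕ./ suc r) (i % suc r)))

  zero? : ∀ {φ} → Periodic φ → Dec (Zero φ)
  zero? {φ} per = map′ (λ h j → trans (sym (periodic-% {φ} per j)) (trans (cong φ (sym (toℕ-fromℕ< (m%n<n j (suc r))))) (h (fromℕ< (m%n<n j (suc r))))))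
    (λ h i → h (toℕ i)) (all? {n = suc r} λ i → φ (toℕ i) Bool.≟ false)

  representative : ∀ {φ} → Periodic φ → ∀ a → ∃ λ b → b ∈ sublists (upTo (suc r)) × a ▹ φ ≗ b ▹ φ
  representative per [] = [] , nil∈ (upTo (suc r)) , λ _ → refl
    where
    nil∈ : ∀ (xs : List ℕ) → [] ∈ sublists xs
    nil∈ []       = here refl
    nil∈ (x ∷ xs) = ∈-++⁺ʳ _ (nil∈ xs)
  representative {φ} per (i ∷ a) with representative per a
  ... | b , b∈ , eq with toggle (upTo (suc r)) (i % suc r) b (∈-upTo⁺ (m%n<n i (suc r))) b∈
  ...   | b′ , b′∈ , eq′ = b′ , b′∈ , λ j → trans (cong₂ _xor_ (reduce j) (eq j)) (eq′ (λ k → φ (j + k)))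
    where
    reduce : ∀ j → φ (j + i) ≡ φ (j + i % suc r)
    reduce j = trans (cong φ (trans (cong (j ℕ.+_) (trans (m≡m%n+[m/n]*n i (suc r)) (ℕ.+-comm (i % suc r) _))) (x+[y+z]≡y+[x+z] j (i ℕ./ suc r ℕ.* suc r) (i % suc r))))
      (periodic-* {φ} per (i ℕ./ suc r) (j + i % suc r))
      where
      x+[y+z]≡y+[x+z] : ∀ x y z → x + (y + z) ≡ y + (x + z)
      x+[y+z]≡y+[x+z] x y z = trans (sym (ℕ.+-assoc x y z)) (trans (cong (_+ z) (ℕ.+-comm x y)) (ℕ.+-assoc y x z))

  -- Raising to the power `2 ^ m` is additive in characteristic two, and it fixes each power of `Y`,
  -- because the period of `φ` divides `2 ^ m - 1`.
  powᴸ-2^m : ∀ {φ} → Periodic φ → ∀ a → powᴸ a (suc (suc r)) ▹ φ ≗ a ▹ φ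
  powᴸ-2^m {φ} per a = ≡.subst₂ (λ b e → b ▹ φ ≗ a ▹ φ) (trans (↑≡powᴸ φ a (2 ℕ.^ m)) (cong (powᴸ a) 2^m)) 2^m (fixed a)
    where
    open CharTwo (seqRing φ) (seqRing-double φ)
    fixed : ∀ a → a ↑ (2 ℕ.^ m) ≈ a
    fixed [] rewrite 2^m = λ _ → refl
    fixed (i ∷ a) = ≈-trans {(i ∷ a) ↑ (2 ℕ.^ m)} {(i ∷ []) ↑ (2 ℕ.^ m) ⊕ a ↑ (2 ℕ.^ m)} {i ∷ a} (frobenius m (i ∷ []) a)
      (+-cong {(i ∷ []) ↑ (2 ℕ.^ m)} {i ∷ []} {a ↑ (2 ℕ.^ m)} {a} monomial (fixed a))
      where
      monomial : (i ∷ []) ↑ (2 ℕ.^ m) ≈ i ∷ []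
      monomial j rewrite ↑≡powᴸ φ (i ∷ []) (2 ℕ.^ m) | powᴸ-monomial i (2 ℕ.^ m) | 2^m = cong (_xor false)
        (trans (cong φ (trans (sym (ℕ.+-assoc j i (suc r ℕ.* i))) (trans (ℕ.+-comm (j + i) _) (cong (_+ (j + i)) (ℕ.*-comm (suc r) i)))))
          (periodic-* {φ} per i (j + i)))

  ZeroOrUnit : List ℕ → Seq → Set
  ZeroOrUnit a φ = Zero (a ▹ φ) ⊎ powᴸ a (suc r) ▹ φ ≗ φ

  -- All operators commute, so an element that is already zero or invertible remains so under the
  -- refinements made for the other elements.
  ZeroOrUnit-▹ : ∀ a w {φ χ} → χ ≗ w ▹ φ → ZeroOrUnit a φ → ZeroOrUnit a χ
  ZeroOrUnit-▹ a w {φ} eq (inj₁ null) = inj₁ λ j → trans (▹-cong a eq j) (trans (▹-comm a w φ j) (▹-zero w null j))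
  ZeroOrUnit-▹ a w {φ} eq (inj₂ unit) = inj₂ λ j → trans (▹-cong b eq j) (trans (▹-comm b w φ j) (trans (▹-cong w unit j) (sym (eq j))))
    where b = powᴸ a (suc r)

  record Refinement (φ : Seq) (as : List (List ℕ)) : Set where
    field
      seq      : Seq
      factor   : List ℕ
      multiple : seq ≗ factor ▹ φ
      periodic : Periodic seq
      nonzero  : ¬ Zero seq
      units    : ListAll.All (λ a → ZeroOrUnit a seq) as

  -- Replacing φ by a ▹ φ, when this is not zero, makes a invertible.
  refine : ∀ as {φ} → Periodic φ → ¬ Zero φ → Refinement φ as
  refine [] {φ} per nz = record { seq = φ ; factor = 0 ∷ [] ; multiple = λ j → sym (▹-1 φ j) ; periodic = per ; nonzero = nz ; units = [] }
  refine (a ∷ as) {φ} per nz with zero? {a ▹ φ} (▹-periodic a {φ} per)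
  ... | yes null = record { seq = R.seq ; factor = R.factor ; multiple = R.multiple ; periodic = R.periodic ; nonzero = R.nonzero
                          ; units = ZeroOrUnit-▹ a R.factor {φ} R.multiple (inj₁ null) ∷ R.units }
    where module R = Refinement (refine as per nz)
  ... | no ¬null = record { seq = R.seq ; factor = R.factor *ᴸ a ; multiple = λ j → trans (R.multiple j) (sym (▹-* R.factor a φ j))
                          ; periodic = R.periodic ; nonzero = R.nonzero
                          ; units = ZeroOrUnit-▹ a R.factor {a ▹ φ} R.multiple (inj₂ unit) ∷ R.units }
    where
    module R = Refinement (refine as (▹-periodic a per) ¬null)
    -- The left side is `a` raised to `2 ^ m` acting on `φ`, which is the action of `a`.
    unit : powᴸ a (suc r) ▹ a ▹ φ ≗ a ▹ φ
    unit j = trans (▹-comm (powᴸ a (suc r)) a φ j) (trans (sym (▹-* a (powᴸ a (suc r)) φ j)) (powᴸ-2^m per a j))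

  -- There are no nilpotents: the power `suc r` of `a` fixes every multiple `a ▹ χ` of a periodic
  -- `χ`, so `a` cannot kill a nonzero multiple of itself.
  nonzero-factor : ∀ a {φ χ} → Periodic χ → φ ≗ a ▹ χ → ¬ Zero φ → ¬ Zero (a ▹ φ)
  nonzero-factor a {φ} {χ} per eq nz null = nz λ j → trans (sym (kept j)) (killed j)
    where
    kept : powᴸ a (suc r) ▹ φ ≗ φ
    kept j = trans (▹-cong (powᴸ a (suc r)) eq j) (trans (▹-comm (powᴸ a (suc r)) a χ j)
      (trans (sym (▹-* a (powᴸ a (suc r)) χ j)) (trans (powᴸ-2^m per a j) (sym (eq j)))))
    killed : Zero (powᴸ a (suc r) ▹ φ)
    killed j = trans (▹-* a (powᴸ a r) φ j) (trans (▹-comm a (powᴸ a r) φ j) (▹-zero (powᴸ a r) null j))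

  gap-factor : ∀ {φ} → Periodic φ → ∀ j J → 1 ≤ j → j ≤ J → ∃ λ χ → Periodic χ × gapProduct J ▹ φ ≗ gap j ▹ χ
  gap-factor {φ} per j zero    1≤j j≤0 = contradiction (ℕ.≤-trans 1≤j j≤0) λ ()
  gap-factor {φ} per j (suc J) 1≤j j≤J with j ℕ.≟ suc J
  ... | yes refl = gapProduct J ▹ φ , ▹-periodic (gapProduct J) per , ▹-* (gap j) (gapProduct J) φ
  ... | no j≢ with gap-factor per j J 1≤j (ℕ.≤-pred (ℕ.≤∧≢⇒< j≤J j≢))
  ...   | χ , perχ , eq = gap (suc J) ▹ χ , ▹-periodic (gap (suc J)) perχ ,
    λ i → trans (▹-* (gap (suc J)) (gapProduct J) φ i) (trans (▹-cong (gap (suc J)) eq i) (▹-comm (gap (suc J)) (gap j) χ i))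

  -- The support is the residue class of `r`, the degree of `gapProduct (m - 1)`; hence the product
  -- acting on `δ` has its leading coefficient at position 0.
  δ : Seq
  δ i = does (i % suc r ℕ.≟ r)

  record FieldSequence : Set where
    field
      seq      : Seq
      periodic : Periodic seq
      nonzero  : ¬ Zero seq
      units    : ∀ a → ZeroOrUnit a seq
      gap-units  : ∀ j → 1 ≤ j → j < m → ¬ Zero (gap j ▹ seq)

fieldSequence : ∀ m r (2^m : 2 ℕ.^ m ≡ suc (suc r)) → FieldSequence m r 2^m
fieldSequence zero r ()
fieldSequence m@(suc J) r 2^m = record
  { seq = F.seq ; periodic = F.periodic ; nonzero = F.nonzero ; units = units ; gap-units = gap-units }
  where
  δ′ = δ m r 2^m
  D≡r : gapDegree J ≡ r
  D≡r = ℕ.suc-injective (ℕ.suc-injective (trans (2+gapDegree≡2^ J) 2^m))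
  δ-periodic : Periodic m r 2^m δ′
  δ-periodic i = cong (λ k → does (k ℕ.≟ r)) (trans (cong (_% suc r) (ℕ.+-comm (suc r) i)) ([m+n]%n≡m%n i (suc r)))
  start : Seq
  start = gapProduct J ▹ δ′
  start-periodic : Periodic m r 2^m start
  start-periodic = ▹-periodic m r 2^m (gapProduct J) δ-periodic
  start-nonzero : ¬ Zero start
  start-nonzero null with trans (sym (null 0)) (trans (pair-gapProduct J δ′ low) high)
    where
    low : ∀ i → i < gapDegree J → δ′ i ≡ false
    low i i<D = dec-false (i % suc r ℕ.≟ r) λ eq → ℕ.<⇒≢ (≡.subst (i <_) D≡r i<D)
      (trans (sym (m<n⇒m%n≡m (ℕ.m<n⇒m<1+n (≡.subst (i <_) D≡r i<D)))) eq)
    high : δ′ (gapDegree J) ≡ true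
    high = dec-true (gapDegree J % suc r ℕ.≟ r) (trans (cong (_% suc r) D≡r) (m<n⇒m%n≡m (ℕ.n<1+n r)))
  ... | ()
  -- Modulo the period every polynomial is a sum of distinct powers below `suc r`, so treating these
  -- sublists treats all polynomials.
  module F = Refinement (refine m r 2^m (sublists (upTo (suc r))) start-periodic start-nonzero)
  units : ∀ a → ZeroOrUnit m r 2^m a F.seq
  units a with representative m r 2^m F.periodic a
  ... | b , b∈ , eq with ListAll.lookup F.units b∈
  ...   | inj₁ null = inj₁ λ j → trans (eq j) (null j)
  ...   | inj₂ unit = inj₂ λ j → trans (powᴸ-cong (suc r) j) (unit j)
    where
    open CommutativeRing (seqRing F.seq) using (*-cong)
    powᴸ-cong : ∀ k → powᴸ a k ▹ F.seq ≗ powᴸ b k ▹ F.seq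
    powᴸ-cong zero    j = refl
    powᴸ-cong (suc k) = *-cong {a} {b} {powᴸ a k} {powᴸ b k} eq (powᴸ-cong k)
  -- The starting sequence is a multiple of every gap, hence so is its refinement, and a nonzero
  -- multiple of a gap is not killed by it.
  gap-units : ∀ j → 1 ≤ j → j < m → ¬ Zero (gap j ▹ F.seq)
  gap-units j 1≤j j<m with gap-factor m r 2^m δ-periodic j J 1≤j (ℕ.≤-pred j<m)
  ... | χ , perχ , eq = nonzero-factor m r 2^m (gap j) (▹-periodic m r 2^m F.factor perχ)
    (λ i → trans (F.multiple i) (trans (▹-cong F.factor eq i) (▹-comm F.factor (gap j) χ i))) F.nonzero

-- Negation is the identity, so the field has characteristic two.
record FiniteField (Q r : ℕ) : Set where
  field
    _+ᶠ_ _*ᶠ_ : Op₂ (Fin Q)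
    0ᶠ 1ᶠ : Fin Q
    isCommutativeRing : IsCommutativeRing _≡_ _+ᶠ_ _*ᶠ_ id 0ᶠ 1ᶠ

  ring : CommutativeRing 0ℓ 0ℓ
  ring = record { isCommutativeRing = isCommutativeRing }

  double : ∀ x → x +ᶠ x ≡ 0ᶠ
  double = CommutativeRing.-‿inverseʳ ring

  field
    isField : CharTwo.IsField ring double r

-- Enumeration of a field by the binary polynomials in an element of degree m

module Enumerate
  (R : CommutativeRing 0ℓ 0ℓ)
  (double : ∀ x → CommutativeRing._≈_ R (CommutativeRing._+_ R x x) (CommutativeRing.0# R))
  {r m : ℕ} (isField : CharTwo.IsField R double r) (2^m : 2 ℕ.^ m ≡ suc (suc r))
  (_≈?_ : Decidable (CommutativeRing._≈_ R))
  (y : CommutativeRing.Carrier R)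
  (y-degree : ∀ k → 1 ≤ k → k < m → ¬ CommutativeRing._≈_ R (CharTwo._↑_ R double y (2 ℕ.^ k)) y)
  where
  open CharTwo R double
  open Solver using (solve; _:=_; _:+_; _:*_; con)
  open IsField isField

  conj : ℕ → Carrier
  conj i = y ↑ (2 ℕ.^ i)

  -- Frobenius is additive and has no kernel, so the first `i` squarings can be stripped from both
  -- sides.
  conj-distinct : ∀ {i j} → i < j → j < m → ¬ conj i ≈ conj j
  conj-distinct {i} {j} i<j j<m eq = y-degree (j ℕ.∸ i) (ℕ.m<n⇒0<n∸m i<j) (ℕ.≤-<-trans (ℕ.m∸n≤m j i) j<m)
    (⊕≈0⇒≈ (↑≈0 (2 ℕ.^ i) _ (≈-trans (frobenius i (conj (j ℕ.∸ i)) y) (≈⇒⊕≈0 (≈-trans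
      (≈-trans (^-assocʳ y (2 ℕ.^ (j ℕ.∸ i)) (2 ℕ.^ i)) (^-congʳ y exponent)) (≈-sym eq))))))
    where
    exponent : 2 ℕ.^ (j ℕ.∸ i) ℕ.* 2 ℕ.^ i ≡ 2 ℕ.^ j
    exponent = trans (sym (ℕ.^-distribˡ-+-* 2 (j ℕ.∸ i) i)) (cong (2 ℕ.^_) (ℕ.m∸n+n≡m (ℕ.<⇒≤ i<j)))

  conj-injective : ∀ {i j : Fin m} → conj (toℕ i) ≈ conj (toℕ j) → i ≡ j
  conj-injective {i} {j} eq with ℕ.<-cmp (toℕ i) (toℕ j)
  ... | tri< i<j _ _ = contradiction eq (conj-distinct i<j (toℕ<n j))
  ... | tri≈ _ i≡j _ = Fin.toℕ-injective i≡j
  ... | tri> _ _ j<i = contradiction (≈-sym eq) (conj-distinct j<i (toℕ<n i))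

  bit : Fin 2 → Carrier
  bit zero       = 0#
  bit (suc zero) = 1#

  bit-frobenius : ∀ i b → bit b ↑ (2 ℕ.^ i) ≈ bit b
  bit-frobenius i (suc zero) = 1↑ (2 ℕ.^ i)
  bit-frobenius zero    zero = zeroˡ _
  bit-frobenius (suc i) zero = ≈-trans (≈-sym (^-assocʳ 0# 2 (2 ℕ.^ i)))
    (≈-trans (^-congˡ (2 ℕ.^ i) (zeroˡ _)) (bit-frobenius i zero))

  bit-injective : ∀ {b c} → bit b ≈ bit c → b ≡ c
  bit-injective {zero}     {zero}     eq = refl
  bit-injective {zero}     {suc zero} eq = contradiction (≈-sym eq) 1≉0
  bit-injective {suc zero} {zero}     eq = contradiction eq 1≉0
  bit-injective {suc zero} {suc zero} eq = refl

  horner-frobenius : ∀ i {e} (b : Fin e → Fin 2) x →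
    horner (tabulate (bit ∘ b)) x ↑ (2 ℕ.^ i) ≈ horner (tabulate (bit ∘ b)) (x ↑ (2 ℕ.^ i))
  horner-frobenius i {zero}  b x = bit-frobenius i zero
  horner-frobenius i {suc e} b x = ≈-trans (frobenius i (bit (b zero)) _)
    (+-cong (bit-frobenius i (b zero)) (≈-trans (^-distrib-* x _ (2 ℕ.^ i)) (*-congˡ (horner-frobenius i (b ∘ suc) x))))

  bits : Fin (2 ℕ.^ m) → Vec Carrier m
  bits c = tabulate (bit ∘ finToFun {2} {m} c)

  to : Fin (2 ℕ.^ m) → Carrier
  to c = horner (bits c) y

  -- A polynomial over 𝔽₂ that vanishes at `y` vanishes at all `m` distinct conjugates of `y`, too
  -- many for a nonzero one of degree below `m`.
  to-injective : ∀ {c c′} → to c ≈ to c′ → c ≡ c′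
  to-injective {c} {c′} eq = finToFun-injective {2} {m} (equal (finToFun c) (finToFun c′) zeros)
    where
    zeros : All (_≈ 0#) (Vec.zipWith _⊕_ (bits c) (bits c′))
    zeros = roots⇒zero (Vec.zipWith _⊕_ (bits c) (bits c′)) (conj ∘ toℕ) conj-injective λ i → ≈-trans (horner-+ (bits c) (bits c′) (conj (toℕ i)))
      (≈⇒⊕≈0 (≈-trans (≈-sym (horner-frobenius (toℕ i) (finToFun {2} {m} c) y))
        (≈-trans (^-congˡ (2 ℕ.^ toℕ i) eq) (horner-frobenius (toℕ i) (finToFun {2} {m} c′) y))))
    equal : ∀ {e} (b b′ : Fin e → Fin 2) → All (_≈ 0#) (Vec.zipWith _⊕_ (tabulate (bit ∘ b)) (tabulate (bit ∘ b′))) → b ≗ b′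
    equal b b′ (p ∷ ps) zero    = bit-injective (⊕≈0⇒≈ p)
    equal b b′ (p ∷ ps) (suc i) = equal (b ∘ suc) (b′ ∘ suc) ps i

  -- Every element is a root of `x ↑ (2 ^ m) ≈ x`; the values of `to` already exhaust the possible
  -- number of roots.
  surjective : ∀ x → ∃ λ c → to c ≈ x
  surjective x with any? (λ c → to c ≈? x)
  ... | yes p = p
  ... | no ¬p = contradiction (λ i → x↑[2+n]≈x (roots i)) (fixed-roots roots roots-injective)
    where
    roots : Fin (suc (suc (suc r))) → Carrier
    roots zero    = x
    roots (suc i) = to (Fin.cast (sym 2^m) i)
    roots-injective : ∀ {i j} → roots i ≈ roots j → i ≡ j
    roots-injective {zero}  {zero}  eq = refl
    roots-injective {zero}  {suc j} eq = contradiction (_ , ≈-sym eq) ¬p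
    roots-injective {suc i} {zero}  eq = contradiction (_ , eq) ¬p
    roots-injective {suc i} {suc j} eq = cong suc (Fin.toℕ-injective (trans (sym (Fin.toℕ-cast (sym 2^m) i))
      (trans (cong toℕ (to-injective eq)) (Fin.toℕ-cast (sym 2^m) j))))

  from : Carrier → Fin (2 ℕ.^ m)
  from x = proj₁ (surjective x)

  to-from : ∀ x → to (from x) ≈ x
  to-from x = proj₂ (surjective x)

  rawᶠ : RawRing 0ℓ 0ℓ
  rawᶠ = record
    { Carrier = Fin (2 ℕ.^ m) ; _≈_ = _≡_ ; _+_ = λ a b → from (to a ⊕ to b) ; _*_ = λ a b → from (to a ⊗ to b)
    ; -_ = id ; 0# = from 0# ; 1# = from 1# }

  finiteField : FiniteField (2 ℕ.^ m) r
  finiteField = record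
    { isCommutativeRing = RM.isCommutativeRing (CommutativeRing.isCommutativeRing R)
    ; isField = record { 1≉0 = λ eq → 1≉0 (≈-trans (≈-sym (to-from 1#)) (≈-trans (reflexive (cong to eq)) (to-from 0#))) ; unit = unit′ } }
    where
    mono : IsRingMonomorphism rawᶠ (CommutativeRing.rawRing R) to
    mono = record
      { isRingHomomorphism = record
        { isSemiringHomomorphism = record
          { isNearSemiringHomomorphism = record
            { +-isMonoidHomomorphism = record
              { isMagmaHomomorphism = record { isRelHomomorphism = record { cong = λ eq → reflexive (cong to eq) } ; homo = λ a b → to-from _ }
              ; ε-homo = to-from 0# }
            ; *-homo = λ a b → to-from _ }
          ; 1#-homo = to-from 1# }
        ; -‿homo = λ a → ≈-trans (≈-sym (+-identityˡ _)) (≈-trans (+-congʳ (≈-sym (CommutativeRing.-‿inverseˡ R (to a))))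
            (≈-trans (+-assoc _ _ _) (≈-trans (+-congˡ (double (to a))) (+-identityʳ _)))) }
      ; injective = to-injective }
    module RM = Algebra.Morphism.RingMonomorphism mono
    F : CommutativeRing 0ℓ 0ℓ
    F = record { isCommutativeRing = RM.isCommutativeRing (CommutativeRing.isCommutativeRing R) }
    module F = CharTwo F (CommutativeRing.-‿inverseʳ F)
    to-↑ : ∀ a k → to (a F.↑ k) ≈ to a ↑ k
    to-↑ a zero    = to-from 1#
    to-↑ a (suc k) = ≈-trans (to-from _) (*-congˡ (to-↑ a k))
    unit′ : ∀ a → a ≡ F.0# ⊎ a F.↑ suc r ≡ F.1#
    unit′ a with unit (to a)
    ... | inj₁ eq = inj₁ (to-injective (≈-trans eq (≈-sym (to-from 0#))))
    ... | inj₂ eq = inj₂ (to-injective (≈-trans (to-↑ a (suc r)) (≈-trans eq (≈-sym (to-from 1#)))))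

abstract
  finiteField : ∀ m r → 2 ℕ.^ m ≡ suc (suc r) → FiniteField (2 ℕ.^ m) r
  finiteField m r 2^m = Enumerate.finiteField (seqRing seq) (seqRing-double seq) {r} {m} isField 2^m _≈?_ (1 ∷ []) degree
    where
    open FieldSequence (fieldSequence m r 2^m)
    open CharTwo (seqRing seq) (seqRing-double seq)
    isField : IsField r
    isField = record
      { 1≉0 = λ eq → nonzero λ j → trans (sym (▹-1 seq j)) (eq j)
      ; unit = unit }
      where
      unit : ∀ a → a ≈ 0# ⊎ a ↑ suc r ≈ 1#
      unit a with units a
      ... | inj₁ null = inj₁ null
      ... | inj₂ u rewrite ↑≡powᴸ seq a (suc r) = inj₂ λ j → trans (u j) (sym (▹-1 seq j))
    _≈?_ : Decidable _≈_
    a ≈? b = map′ (λ null → ⊕≈0⇒≈ {a} {b} null) (λ eq → ≈⇒⊕≈0 {a} {b} eq) (zero? m r 2^m (▹-periodic m r 2^m (a ++ b) periodic))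
    degree : ∀ k → 1 ≤ k → k < m → ¬ (1 ∷ []) ↑ (2 ℕ.^ k) ≈ 1 ∷ []
    degree k 1≤k k<m eq = gap-units k 1≤k k<m (≡.subst (λ a → Zero (a ▹ seq)) gap≡ (≈⇒⊕≈0 {(1 ∷ []) ↑ (2 ℕ.^ k)} {1 ∷ []} eq))
      where
      gap≡ : ((1 ∷ []) ↑ (2 ℕ.^ k)) ++ 1 ∷ [] ≡ gap k
      gap≡ = trans (cong (_++ 1 ∷ []) (trans (↑≡powᴸ seq (1 ∷ []) (2 ℕ.^ k)) (powᴸ-monomial 1 (2 ℕ.^ k))))
        (cong (λ i → i ∷ 1 ∷ []) (ℕ.*-identityʳ (2 ℕ.^ k)))

-- The norm colouring

lookup-pairs : ∀ {A : Set} {R : Rel A 0ℓ} {xs} → AllPairs R xs → ∀ {i j} → toℕ i < toℕ j → R (lookup xs i) (lookup xs j)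
lookup-pairs (p ∷ ps) {zero}  {suc j} i<j = ListAll.lookup p (∈-lookup j)
lookup-pairs (p ∷ ps) {suc i} {suc j} i<j = lookup-pairs ps (ℕ.≤-pred i<j)

lookup-injective : ∀ {A : Set} {xs : List A} → Unique xs → ∀ {i j} → lookup xs i ≡ lookup xs j → i ≡ j
lookup-injective u {i} {j} eq with ℕ.<-cmp (toℕ i) (toℕ j)
... | tri< i<j _ _ = contradiction eq (lookup-pairs u i<j)
... | tri≈ _ i≡j _ = toℕ-injective i≡j
... | tri> _ _ j<i = contradiction (sym eq) (lookup-pairs u j<i)

module Fibres {N M} (f : Fin N → Fin M) where

  fibre : Fin M → List (Fin N)
  fibre c = filter (λ i → f i Fin.≟ c) (allFin N)

  fibre-unique : ∀ c → Unique (fibre c)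
  fibre-unique c = Unique.filter⁺ (λ i → f i Fin.≟ c) (Unique.allFin⁺ N)

  fibre-lookup : ∀ c i → f (lookup (fibre c) i) ≡ c
  fibre-lookup c i = ListAll.lookup (all-filter (λ i → f i Fin.≟ c) (allFin N)) (∈-lookup i)

  fibres-bound : ∀ {B} → (∀ c → length (fibre c) ≤ B) → N ≤ M ℕ.* B
  fibres-bound {B} bound = injective⇒≤ λ {i} {j} eq → locate-injective (proj₁ (split i j eq)) (proj₂ (split i j eq))
    where
    index : ∀ c i → f i ≡ c → Fin (length (fibre c))
    index c i fi≡c = Any.index (∈-filter⁺ (λ i → f i Fin.≟ c) (∈-allFin i) fi≡c)
    position : Fin N → Fin B
    position i = inject≤ (index (f i) i refl) (bound (f i))
    locate : Fin N → Fin (M ℕ.* B)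
    locate i = combine (f i) (position i)
    split : ∀ i j → locate i ≡ locate j → f i ≡ f j × position i ≡ position j
    split i j = combine-injective (f i) (position i) (f j) (position j)
    at-index : ∀ c i fi≡c → lookup (fibre c) (index c i fi≡c) ≡ i
    at-index c i fi≡c = sym (lookup-index (∈-filter⁺ (λ i → f i Fin.≟ c) (∈-allFin i) fi≡c))
    same-fibre : ∀ c i j (p : f i ≡ c) (q : f j ≡ c) → index c i p ≡ index c j q → i ≡ j
    same-fibre c i j p q eq = trans (sym (at-index c i p)) (trans (cong (lookup (fibre c)) eq) (at-index c j q))
    toℕ-position : ∀ c i (p : f i ≡ c) → toℕ (position i) ≡ toℕ (index c i p)
    toℕ-position c i refl = toℕ-inject≤ (index (f i) i refl) (bound (f i))
    locate-injective : ∀ {i j} → f i ≡ f j → position i ≡ position j → i ≡ j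
    locate-injective {i} {j} fi≡fj eq = same-fibre (f j) i j fi≡fj refl (toℕ-injective
      (trans (sym (toℕ-position (f j) i fi≡fj)) (trans (cong toℕ eq) (toℕ-position (f j) j refl))))

  large-fibre : ∀ .{{_ : ℕ.NonZero M}} .{{_ : ℕ.NonZero N}} → ∃ λ c → N ≤ M ℕ.* length (fibre c)
  large-fibre with any? (λ c → N ℕ.≤? M ℕ.* length (fibre c))
  ... | yes p = p
  ... | no ¬p = contradiction (fibres-bound small) (ℕ.<⇒≱ (ℕ.≤-<-trans
      (ℕ.≤-trans (ℕ.≤-reflexive (ℕ.*-comm M _)) (m/n*n≤m (ℕ.pred N) M)) (ℕ.≤-reflexive (ℕ.suc-pred N))))
    where
    small : ∀ c → length (fibre c) ≤ ℕ.pred N ℕ./ M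
    small c = *≤⇒≤/ (ℕ.≤-pred (ℕ.≤-trans (ℕ.≰⇒> (λ le → ¬p (c , le))) (ℕ.≤-reflexive (sym (ℕ.suc-pred N)))))
      where
      *≤⇒≤/ : ∀ {x y} → M ℕ.* x ≤ y → x ≤ y ℕ./ M
      *≤⇒≤/ {x} {y} le = ℕ.≤-trans (ℕ.≤-reflexive (sym (m*n/n≡m x M))) (/-monoˡ-≤ M (ℕ.≤-trans (ℕ.≤-reflexive (ℕ.*-comm x M)) le))

greedy : ∀ {A : Set} {R : Rel A 0ℓ} → Decidable R → (∀ x → R x x) → (xs : List A) →
  ∃ λ ys → AllPairs (λ x y → ¬ R x y) ys × (∀ {y} → y ∈ ys → y ∈ xs) × (∀ {x} → x ∈ xs → Any (R x) ys)
greedy R? R-refl [] = [] , [] , (λ ()) , λ ()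
greedy R? R-refl (x ∷ xs) with greedy R? R-refl xs
... | ys , apart , sub , cover with Any.any? (R? x) ys
...   | yes p = ys , apart , there ∘ sub , λ { (here refl) → p ; (there x∈) → cover x∈ }
...   | no ¬p = x ∷ ys , ListAll.¬Any⇒All¬ ys ¬p ∷ apart , (λ { (here eq) → here eq ; (there y∈) → there (sub y∈) }) ,
  λ { (here refl) → here (R-refl x) ; (there x∈) → there (cover x∈) }

-- This is all that the hypergraph takes from the field. In `agree≤` the common colour may change
-- with `l`, since only edges sharing the same (2k-1)-set are compared.
record Colouring (Q M T s : ℕ) : Set where
  field
    colour : Fin Q → Fin Q → Fin M
    colour-sym : ∀ x y → colour x y ≡ colour y x
    agree≤ : ∀ {N} (x : Fin s → Fin Q) (y : Fin N → Fin Q) → Injective _≡_ _≡_ x → Injective _≡_ _≡_ y →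
      (∀ i j l → colour (x i) (y l) ≡ colour (x j) (y l)) → N ≤ T

-- The sum 1 + q + ... + q^(k-1), so that the norm from 𝔽_{q^k} to 𝔽_q is z ↦ z ↑ repunit q k.
repunit : ℕ → ℕ → ℕ
repunit q zero    = 0
repunit q (suc k) = suc (q ℕ.* repunit q k)

repunit-geometric : ∀ q k → repunit q k ℕ.* q + 1 ≡ repunit q k + q ℕ.^ k
repunit-geometric q zero    = refl
repunit-geometric q (suc k) = begin
  suc (q ℕ.* E) ℕ.* q + 1        ≡⟨ solve 2 (λ q e → (con 1 :+ q :* e) :* q :+ con 1 := con 1 :+ q :* (e :* q :+ con 1)) refl q E ⟩
  1 + q ℕ.* (E ℕ.* q + 1)        ≡⟨ cong (λ x → 1 + q ℕ.* x) (repunit-geometric q k) ⟩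
  1 + q ℕ.* (E + q ℕ.^ k)        ≡⟨ cong suc (ℕ.*-distribˡ-+ q E (q ℕ.^ k)) ⟩
  suc (q ℕ.* E) + q ℕ.^ suc k    ∎
  where
  E = repunit q k
  open +-*-Solver using (solve; _:=_; _:+_; _:*_; con)
  open ≡.≡-Reasoning

module NormColouring (a d′ e r : ℕ) (q≡ : 2 ℕ.^ a ≡ suc (suc e)) (Q≡ : 2 ℕ.^ (a ℕ.* suc d′) ≡ suc (suc r))
  (F : FiniteField (2 ℕ.^ (a ℕ.* suc d′)) r) (h′ : ℕ) (h²<q : suc h′ ℕ.* suc h′ < 2 ℕ.^ a) where

  private module F = FiniteField F
  open CharTwo F.ring F.double
  open Solver using (solve; _:=_; _:+_; _:*_; con)
  open IsField F.isField
  open Staircase F.ring F.double F.isField using (Π; Point; inv; ⊗-inv; module Count)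

  q Q d h E : ℕ
  q = 2 ℕ.^ a
  Q = 2 ℕ.^ (a ℕ.* suc d′)
  d = suc d′
  h = suc h′
  E = repunit q d

  norm : Carrier → Carrier
  norm z = z ↑ E

  conj : Carrier → Point
  conj z zero    = z
  conj z (suc j) = conj (z ↑ q) j

  -- As Frobenius is additive, the norm of `y ⊕ x` is the product of the sums of corresponding
  -- conjugates, linear in each conjugate of `y`.
  Π-conj : ∀ k x y → Π k (conj y) (conj x) ≡ (y ⊕ x) ↑ repunit q k
  Π-conj zero    x y = refl
  Π-conj (suc k) x y = cong ((y ⊕ x) ⊗_) (trans (Π-conj k (x ↑ q) (y ↑ q))
    (trans (cong (_↑ repunit q k) (sym (frobenius a y x))) (^-assocʳ (y ⊕ x) q (repunit q k))))

  ↑q-injective : ∀ {x y} → x ↑ q ≡ y ↑ q → x ≡ y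
  ↑q-injective {x} {y} eq = ⊕≈0⇒≈ (↑≈0 q (x ⊕ y) (trans (frobenius a x y) (≈⇒⊕≈0 eq)))

  conj-injective : ∀ j {x y} → conj x j ≡ conj y j → x ≡ y
  conj-injective zero    eq = eq
  conj-injective (suc j) eq = ↑q-injective (conj-injective j eq)

  -- From `E * q + 1 = E + Q` and `z ↑ Q = z` after cancelling one factor `z`; hence the separate
  -- case of zero.
  norm-fixed : ∀ z → norm z ↑ q ≡ norm z
  norm-fixed z with z Fin.≟ 0#
  ... | yes refl = trans (cong (_↑ q) (zeroˡ _)) (trans (cong (0# ↑_) q≡) (trans (zeroˡ _) (sym (zeroˡ _))))
  ... | no z≢0 = ⊗-cancelˡ z≢0 (begin
    z ⊗ norm z ↑ q            ≡⟨ cong (z ⊗_) (^-assocʳ z E q) ⟩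
    z ↑ suc (E ℕ.* q)         ≡⟨ cong (z ↑_) (trans (ℕ.+-comm 1 (E ℕ.* q)) (trans (repunit-geometric q d) (ℕ.+-comm E (q ℕ.^ d)))) ⟩
    z ↑ (q ℕ.^ d + E)         ≡⟨ ^-homo-* z (q ℕ.^ d) E ⟩
    z ↑ (q ℕ.^ d) ⊗ norm z    ≡⟨ cong (λ k → z ↑ k ⊗ norm z) (trans (ℕ.^-*-assoc 2 a d) Q≡) ⟩
    z ↑ suc (suc r) ⊗ norm z  ≡⟨ cong (_⊗ norm z) (x↑[2+n]≈x z) ⟩
    z ⊗ norm z                ∎)
    where open ≡.≡-Reasoning

  roots≤ : ∀ {n} c (zs : List Carrier) → Unique zs → (∀ i → lookup zs i ↑ suc n ≡ c) → length zs ≤ suc n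
  roots≤ {n} c zs u root = ℕ.≮⇒≥ λ lt → constant-roots c (λ i → lookup zs (inject≤ i lt))
    (λ eq → inject≤-injective lt lt _ _ (lookup-injective u eq)) (λ i → root _)

  Torsion : Carrier → Set
  Torsion z = ∃ λ (i : Fin h) → 0 < toℕ i × z ↑ (E ℕ.* toℕ i) ≡ 1#

  torsion? : ∀ z → Dec (Torsion z)
  torsion? z = any? λ i → (0 ℕ.<? toℕ i) ×-dec (z ↑ (E ℕ.* toℕ i) Fin.≟ 1#)

  abstract
    -- Counting roots takes the place of a generator of the unit group. Each equation
    -- `z ↑ (E * i) ≡ 1#` has at most `E * i` solutions, and the class `zero` holds only 0, so the
    -- `h` classes could contain at most `h * (E * h)` elements. This is less than `Q`, because
    -- `E * (h * h + 1) ≤ E * q = E + Q - 1`.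
    non-torsion : ∃ λ z → z ≢ 0# × ¬ Torsion z
    non-torsion with any? (λ z → ¬? (z Fin.≟ 0#) ×-dec ¬? (torsion? z))
    ... | yes p = p
    ... | no ¬p = contradiction (fibres-bound bound) (ℕ.<⇒≱ large)
      where
      torsion : ∀ z → z ≡ 0# ⊎ Torsion z
      torsion z with z Fin.≟ 0# | torsion? z
      ... | yes z≡0 | _     = inj₁ z≡0
      ... | no  _   | yes t = inj₂ t
      ... | no  z≢0 | no ¬t = contradiction (z , z≢0 , ¬t) ¬p
      order : Fin Q → Fin h
      order z = Sum.[ (λ _ → zero) , proj₁ ]′ (torsion z)
      open Fibres order
      order-0 : ∀ z → order z ≡ zero → z ↑ 1 ≡ 0#
      order-0 z eq with torsion z
      ... | inj₁ z≡0 = trans (*-identityʳ z) z≡0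
      ... | inj₂ (i , 0<i , _) = contradiction 0<i (subst (λ j → ¬ 0 < toℕ j) (sym eq) λ ())
      order-suc : ∀ z i → order z ≡ suc i → z ↑ (E ℕ.* suc (toℕ i)) ≡ 1#
      order-suc z i eq with torsion z
      order-suc z i ()   | inj₁ _
      order-suc z i refl | inj₂ (_ , _ , t) = t
      bound : ∀ c → length (fibre c) ≤ E ℕ.* h
      bound zero    = ℕ.≤-trans (roots≤ 0# (fibre zero) (fibre-unique zero) (λ i → order-0 _ (fibre-lookup zero i))) (s≤s z≤n)
      bound (suc c) = ℕ.≤-trans (roots≤ 1# (fibre (suc c)) (fibre-unique (suc c)) (λ i → order-suc _ c (fibre-lookup (suc c) i)))
        (ℕ.*-monoʳ-≤ E (ℕ.<⇒≤ (toℕ<n (suc c))))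
      large : h ℕ.* (E ℕ.* h) < Q
      large = ℕ.+-cancelˡ-≤ E _ _ (begin
        E + suc (h ℕ.* (E ℕ.* h))    ≡⟨ N.solve 2 (λ e h → e N.:+ (N.con 1 N.:+ h N.:* (e N.:* h)) N.:= e N.:* (N.con 1 N.:+ h N.:* h) N.:+ N.con 1) refl E h ⟩
        E ℕ.* suc (h ℕ.* h) + 1      ≤⟨ ℕ.+-monoˡ-≤ 1 (ℕ.*-monoʳ-≤ E h²<q) ⟩
        E ℕ.* q + 1                  ≡⟨ repunit-geometric q d ⟩
        E + q ℕ.^ d                  ≡⟨ cong (E ℕ.+_) (ℕ.^-*-assoc 2 a d) ⟩
        E + Q                        ∎)
        where
        module N = +-*-Solver
        open ℕ.≤-Reasoning

  g : Carrier
  g = norm (proj₁ non-torsion)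

  g↑≢0 : ∀ k → g ↑ k ≢ 0#
  g↑≢0 k eq = proj₁ (proj₂ non-torsion) (↑≈0 E _ (↑≈0 k g eq))

  g-powers : ∀ {i j} → i < j → j < h → g ↑ i ≢ g ↑ j
  g-powers {i} {j} i<j j<h eq = proj₂ (proj₂ non-torsion) (fromℕ< δ<h , subst (0 <_) (sym δ≡) (ℕ.m<n⇒0<n∸m i<j) ,
    trans (cong (λ k → z ↑ (E ℕ.* k)) δ≡) (trans (sym (^-assocʳ z E (j ℕ.∸ i))) (sym (⊗-cancelˡ (g↑≢0 i) (begin
      g ↑ i ⊗ 1#               ≡⟨ *-identityʳ _ ⟩
      g ↑ i                    ≡⟨ eq ⟩
      g ↑ j                    ≡⟨ cong (g ↑_) (ℕ.m+[n∸m]≡n (ℕ.<⇒≤ i<j)) ⟨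
      g ↑ (i + (j ℕ.∸ i))      ≡⟨ ^-homo-* g i (j ℕ.∸ i) ⟩
      g ↑ i ⊗ g ↑ (j ℕ.∸ i)    ∎)))))
    where
    open ≡.≡-Reasoning
    z = proj₁ non-torsion
    δ<h : j ℕ.∸ i < h
    δ<h = ℕ.≤-<-trans (ℕ.m∸n≤m j i) j<h
    δ≡ : toℕ (fromℕ< δ<h) ≡ j ℕ.∸ i
    δ≡ = toℕ-fromℕ< δ<h

  g-injective : ∀ {i j : Fin h} → g ↑ toℕ i ≡ g ↑ toℕ j → i ≡ j
  g-injective {i} {j} eq with ℕ.<-cmp (toℕ i) (toℕ j)
  ... | tri< i<j _ _ = contradiction eq (g-powers i<j (toℕ<n j))
  ... | tri≈ _ i≡j _ = toℕ-injective i≡j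
  ... | tri> _ _ j<i = contradiction (sym eq) (g-powers j<i (toℕ<n i))

  Near : Rel Carrier 0ℓ
  Near v c = ∃₂ λ (i j : Fin h) → v ⊗ g ↑ toℕ i ≡ c ⊗ g ↑ toℕ j

  near? : Decidable Near
  near? v c = any? λ i → any? λ j → v ⊗ g ↑ toℕ i Fin.≟ c ⊗ g ↑ toℕ j

  Unit-fixed : Carrier → Set
  Unit-fixed v = v ↑ q ≡ v × v ≢ 0#

  unit-fixed? : ∀ v → Dec (Unit-fixed v)
  unit-fixed? v = (v ↑ q Fin.≟ v) ×-dec ¬? (v Fin.≟ 0#)

  units : List Carrier
  units = filter unit-fixed? (allFin Q)

  abstract
    packing : ∃ λ C → AllPairs (λ v c → ¬ Near v c) C × (∀ {c} → c ∈ C → c ∈ units) × (∀ {v} → v ∈ units → Any (Near v) C)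
    packing = greedy near? (λ v → zero , zero , refl) units

  C : List Carrier
  C = proj₁ packing

  C-unit : ∀ i → Unit-fixed (lookup C i)
  C-unit i = proj₂ (∈-filter⁻ unit-fixed? {xs = allFin Q} (proj₁ (proj₂ (proj₂ packing)) (∈-lookup i)))

  C-apart : ∀ {i j k l} → lookup C i ⊗ g ↑ toℕ {h} k ≡ lookup C j ⊗ g ↑ toℕ {h} l → i ≡ j
  C-apart {i} {j} {k} {l} eq with ℕ.<-cmp (toℕ i) (toℕ j)
  ... | tri< i<j _ _ = contradiction (k , l , eq) (lookup-pairs (proj₁ (proj₂ packing)) i<j)
  ... | tri≈ _ i≡j _ = toℕ-injective i≡j
  ... | tri> _ _ j<i = contradiction (l , k , sym eq) (lookup-pairs (proj₁ (proj₂ packing)) j<i)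

  -- The translates are disjoint and each has `h` distinct elements, all of them among the at most
  -- `q` roots of `x ↑ q ≡ x`.
  ∣C∣*h≤q : length C ℕ.* h ≤ q
  ∣C∣*h≤q = ℕ.≮⇒≥ λ q< → let le = subst (λ n → suc n ≤ length C ℕ.* h) q≡ q< in
    fixed-roots (λ i → value (remQuot h (inject≤ i le)))
      (λ {i} {j} eq → inject≤-injective le le i j (trans (sym (combine-remQuot {length C} h (inject≤ i le)))
        (trans (cong (λ (i , k) → combine i k) (value-injective (remQuot h (inject≤ i le)) (remQuot h (inject≤ j le)) eq)) (combine-remQuot {length C} h (inject≤ j le)))))
      (λ i → trans (cong (value (remQuot h (inject≤ i le)) ↑_) (sym q≡)) (value-fixed (remQuot h (inject≤ i le))))
    where
    value : Fin (length C) × Fin h → Carrier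
    value (i , k) = lookup C i ⊗ g ↑ toℕ k
    value-fixed : ∀ p → value p ↑ q ≡ value p
    value-fixed (i , k) = trans (^-distrib-* (lookup C i) (g ↑ toℕ k) q) (cong₂ _⊗_ (proj₁ (C-unit i)) (begin
      (g ↑ toℕ k) ↑ q      ≡⟨ ^-assocʳ g (toℕ k) q ⟩
      g ↑ (toℕ k ℕ.* q)    ≡⟨ cong (g ↑_) (ℕ.*-comm (toℕ k) q) ⟩
      g ↑ (q ℕ.* toℕ k)    ≡⟨ ^-assocʳ g q (toℕ k) ⟨
      (g ↑ q) ↑ toℕ k      ≡⟨ cong (_↑ toℕ k) (norm-fixed (proj₁ non-torsion)) ⟩
      g ↑ toℕ k            ∎))
      where open ≡.≡-Reasoning
    value-injective : ∀ p p′ → value p ≡ value p′ → p ≡ p′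
    value-injective (i , k) (j , l) eq with C-apart {i} {j} {k} {l} eq
    ... | refl = cong (i ,_) (g-injective (⊗-cancelˡ (proj₂ (C-unit i)) eq))

  class : Carrier → Fin (suc (length C))
  class z with norm z Fin.≟ 0#
  ... | yes _   = zero
  ... | no  N≢0 = suc (Any.index (proj₂ (proj₂ (proj₂ packing)) (∈-filter⁺ unit-fixed? (∈-allFin (norm z)) (norm-fixed z , N≢0))))

  class-zero : ∀ z → class z ≡ zero → z ≡ 0#
  class-zero z eq with norm z Fin.≟ 0#
  ... | yes N≡0 = ↑≈0 E z N≡0

  0-class : ∀ z → z ≡ 0# → class z ≡ zero
  0-class z z≡0 with norm z Fin.≟ 0#
  ... | yes _ = refl
  ... | no N≢0 = contradiction (trans (cong norm z≡0) (zeroˡ _)) N≢0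

  class-suc : ∀ z {i} → class z ≡ suc i → Near (norm z) (lookup C i)
  class-suc z eq with norm z Fin.≟ 0#
  class-suc z refl | no N≢0 = lookup-index (proj₂ (proj₂ (proj₂ packing)) (∈-filter⁺ unit-fixed? (∈-allFin (norm z)) (norm-fixed z , N≢0)))

  L : ℕ
  L = suc (4 ℕ.* h′)

  G : Carrier
  G = g ↑ (2 ℕ.* h′)

  -- The factor G = g ^ 2(h - 1) keeps all the exponents non-negative.
  near-ratio : ∀ {v w c} → Near v c → Near w c → ∃ λ (l : Fin L) → v ⊗ G ≡ g ↑ toℕ l ⊗ w
  near-ratio {v} {w} {c} (i , j , eq) (i′ , j′ , eq′) = fromℕ< l<L , (begin
      v ⊗ G                                                      ≡⟨ cong (λ k → v ⊗ g ↑ k) (ℕ.m+[n∸m]≡n A≤) ⟨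
      v ⊗ g ↑ (A + (2 ℕ.* h′ ℕ.∸ A))                             ≡⟨ cong (v ⊗_) (trans (^-homo-* g A _) (cong (_⊗ g ↑ (2 ℕ.* h′ ℕ.∸ A)) (^-homo-* g (toℕ i) (toℕ j′)))) ⟩
      v ⊗ (g ↑ toℕ i ⊗ g ↑ toℕ j′ ⊗ g ↑ (2 ℕ.* h′ ℕ.∸ A))        ≡⟨ solve 4 (λ v a b k → v :* (a :* b :* k) := (v :* a) :* b :* k) refl v _ _ _ ⟩
      (v ⊗ g ↑ toℕ i) ⊗ g ↑ toℕ j′ ⊗ g ↑ (2 ℕ.* h′ ℕ.∸ A)        ≡⟨ cong (λ x → x ⊗ g ↑ toℕ j′ ⊗ g ↑ (2 ℕ.* h′ ℕ.∸ A)) eq ⟩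
      (c ⊗ g ↑ toℕ j) ⊗ g ↑ toℕ j′ ⊗ g ↑ (2 ℕ.* h′ ℕ.∸ A)        ≡⟨ solve 4 (λ c a b k → (c :* a) :* b :* k := a :* (c :* b) :* k) refl c _ _ _ ⟩
      g ↑ toℕ j ⊗ (c ⊗ g ↑ toℕ j′) ⊗ g ↑ (2 ℕ.* h′ ℕ.∸ A)        ≡⟨ cong (λ x → g ↑ toℕ j ⊗ x ⊗ g ↑ (2 ℕ.* h′ ℕ.∸ A)) eq′ ⟨
      g ↑ toℕ j ⊗ (w ⊗ g ↑ toℕ i′) ⊗ g ↑ (2 ℕ.* h′ ℕ.∸ A)        ≡⟨ solve 4 (λ w a b k → a :* (w :* b) :* k := a :* b :* k :* w) refl w _ _ _ ⟩
      g ↑ toℕ j ⊗ g ↑ toℕ i′ ⊗ g ↑ (2 ℕ.* h′ ℕ.∸ A) ⊗ w          ≡⟨ cong (_⊗ w) (trans (^-homo-* g B _) (cong (_⊗ g ↑ (2 ℕ.* h′ ℕ.∸ A)) (^-homo-* g (toℕ j) (toℕ i′)))) ⟨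
      g ↑ l ⊗ w                                                  ≡⟨ cong (λ k → g ↑ k ⊗ w) (toℕ-fromℕ< l<L) ⟨
      g ↑ toℕ (fromℕ< l<L) ⊗ w                                   ∎)
    where
    open ≡.≡-Reasoning
    A B l : ℕ
    A = toℕ i + toℕ j′
    B = toℕ j + toℕ i′
    l = B + (2 ℕ.* h′ ℕ.∸ A)
    sum≤ : ∀ (i j : Fin h) → toℕ i + toℕ j ≤ 2 ℕ.* h′
    sum≤ i j = ℕ.+-mono-≤ (ℕ.≤-pred (toℕ<n i)) (ℕ.≤-trans (ℕ.≤-pred (toℕ<n j)) (ℕ.m≤m+n h′ 0))
    A≤ : A ≤ 2 ℕ.* h′
    A≤ = sum≤ i j′
    -- Both exponent sums are at most `2 * h′`, whence the `4 * h′ + 1 = 4 * h - 3` possible ratios.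
    l<L : l < L
    l<L = s≤s (ℕ.≤-trans (ℕ.+-mono-≤ (sum≤ j i′) (ℕ.m∸n≤m (2 ℕ.* h′) A)) (ℕ.≤-reflexive (sym (ℕ.*-distribʳ-+ h′ 2 2))))

  class-ratio : ∀ z w → w ≢ 0# → class z ≡ class w → ∃ λ (l : Fin L) → norm z ⊗ G ≡ g ↑ toℕ l ⊗ norm w
  class-ratio z w w≢0 eq with class w in eq-w
  ... | zero  = contradiction (class-zero w eq-w) w≢0
  ... | suc i = near-ratio (class-suc z eq) (class-suc w eq-w)

  1<Q : 1 < Q
  1<Q = subst (1 <_) (sym Q≡) (s≤s (s≤s z≤n))

  open Count {Q} id id id id 1<Q

  module Agreement {N} (x : Fin (suc d) → Carrier) (y : Fin N → Carrier) (x-inj : Injective _≡_ _≡_ x) (y-inj : Injective _≡_ _≡_ y)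
    (agree : ∀ i j l → class (y l ⊕ x i) ≡ class (y l ⊕ x j)) where

    -- The colour `zero` is reserved for 0. If `y l` equalled `x zero`, agreement of colours would
    -- make it equal to `x (suc zero)` as well.
    nonzero : ∀ l → y l ⊕ x zero ≢ 0#
    nonzero l eq with x-inj {zero} {suc zero} (trans (sym (⊕≈0⇒≈ eq)) (⊕≈0⇒≈ (class-zero (y l ⊕ x (suc zero))
      (trans (agree (suc zero) zero l) (0-class (y l ⊕ x zero) eq)))))
    ... | ()

    ratio : ∀ l (i : Fin d) → ∃ λ (k : Fin L) → norm (y l ⊕ x (suc i)) ⊗ G ≡ g ↑ toℕ k ⊗ norm (y l ⊕ x zero)
    ratio l i = class-ratio _ _ (nonzero l) (agree (suc i) zero l)

    ratios : Fin N → Fin (L ℕ.^ d)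
    ratios l = funToFin (λ i → proj₁ (ratio l i))

    open Fibres ratios

    ρ : Fin (L ℕ.^ d) → Fin (suc d) → Carrier
    ρ c zero    = 1#
    ρ c (suc i) = inv G ⊗ g ↑ toℕ (finToFun {L} {d} c i)

    solution : ∀ c l → ratios l ≡ c → ∀ i → Π d (conj (y l)) (conj (x i)) ≡ ρ c i ⊗ Π d (conj (y l)) (conj (x zero))
    solution c l eq zero    = sym (*-identityˡ _)
    solution c l refl (suc i) = begin
      Π d (conj (y l)) (conj (x (suc i)))                ≡⟨ Π-conj d (x (suc i)) (y l) ⟩
      norm (y l ⊕ x (suc i))                             ≡⟨ *-identityʳ _ ⟨
      norm (y l ⊕ x (suc i)) ⊗ 1#                        ≡⟨ cong (norm (y l ⊕ x (suc i)) ⊗_) (⊗-inv (g↑≢0 (2 ℕ.* h′))) ⟨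
      norm (y l ⊕ x (suc i)) ⊗ (G ⊗ inv G)               ≡⟨ solve 3 (λ a b c → a :* (b :* c) := c :* (a :* b)) refl _ _ _ ⟩
      inv G ⊗ (norm (y l ⊕ x (suc i)) ⊗ G)               ≡⟨ cong (inv G ⊗_) (proj₂ (ratio l i)) ⟩
      inv G ⊗ (g ↑ toℕ (proj₁ (ratio l i)) ⊗ norm (y l ⊕ x zero))   ≡⟨ *-assoc _ _ _ ⟨
      inv G ⊗ g ↑ toℕ (proj₁ (ratio l i)) ⊗ norm (y l ⊕ x zero)
        ≡⟨ cong₂ (λ k w → inv G ⊗ g ↑ toℕ k ⊗ w) (sym (finToFun-funToFin (λ i → proj₁ (ratio l i)) i)) (sym (Π-conj d (x zero) (y l))) ⟩
      ρ (ratios l) (suc i) ⊗ Π d (conj (y l)) (conj (x zero)) ∎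
      where open ≡.≡-Reasoning

    N≤ : N ≤ L ℕ.^ d ℕ.* d !
    N≤ = fibres-bound λ c → solutions≤! (λ i → conj (x i)) (λ k eq → x-inj (conj-injective k eq))
      (λ l → conj (y (lookup (fibre c) l))) (λ eq → lookup-injective (fibre-unique c) (y-inj eq)) (ρ c)
      (λ i l → solution c (lookup (fibre c) l) (fibre-lookup c l) i)
      (λ l eq → nonzero (lookup (fibre c) l) (↑≈0 E _ (trans (sym (Π-conj d (x zero) _)) eq)))

  abstract
    colouring : ∃ λ M → suc M ℕ.* h ≤ 2 ℕ.* q × Colouring Q (suc M) (L ℕ.^ d ℕ.* d !) (suc d)
    colouring = length C , colours≤ , record
      { colour     = λ x y → class (y ⊕ x)
      ; colour-sym = λ x y → cong class (+-comm y x)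
      ; agree≤     = λ x y x-inj y-inj agree → Agreement.N≤ x y x-inj y-inj agree }
      where
      -- The extra colour for norm zero contributes `h ≤ h * h < q`, and the packing at most `q`;
      -- this is the origin of the factor 2.
      colours≤ : suc (length C) ℕ.* h ≤ 2 ℕ.* q
      colours≤ = ℕ.≤-trans (ℕ.+-mono-≤ (ℕ.≤-trans (ℕ.m≤m*n h h) (ℕ.<⇒≤ h²<q)) ∣C∣*h≤q) (ℕ.≤-reflexive (cong (q ℕ.+_) (sym (ℕ.+-identityʳ q))))

-- Hypergraphs of transversals

image-∈⁺ : ∀ {m n} (f : Fin m → Fin n) p {x} → x ∈ˢ p → f x ∈ˢ image f p
image-∈⁺ f p {x} x∈p = lookup⇒[]= (f x) (image f p) (trans (lookup∘tabulate _ (f x))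
  (dec-true (any? λ z → (z ∈ˢ? p) ×-dec (f z Fin.≟ f x)) (x , x∈p , refl)))

image-∈⁻ : ∀ {m n} (f : Fin m → Fin n) p {y} → y ∈ˢ image f p → ∃ λ x → x ∈ˢ p × f x ≡ y
image-∈⁻ f p {y} y∈ = witness (any? λ z → (z ∈ˢ? p) ×-dec (f z Fin.≟ y))
  (trans (sym (lookup∘tabulate _ y)) ([]=⇒lookup y∈))
  where
  witness : ∀ {A : Set} (a? : Dec A) → does a? ≡ true → A
  witness (yes a) _ = a

∣[]≔inside∣ : ∀ {n} (p : Subset n) x → ¬ x ∈ˢ p → ∣ p [ x ]≔ inside ∣ ≡ suc ∣ p ∣
∣[]≔inside∣ (outside ∷ p) zero    x∉ = refl
∣[]≔inside∣ (inside  ∷ p) zero    x∉ = contradiction here x∉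
∣[]≔inside∣ (outside ∷ p) (suc x) x∉ = ∣[]≔inside∣ p x (x∉ ∘ there)
∣[]≔inside∣ (inside  ∷ p) (suc x) x∉ = cong suc (∣[]≔inside∣ p x (x∉ ∘ there))

∣image⊤∣ : ∀ {m n} (f : Fin m → Fin n) → Injective _≡_ _≡_ f → ∣ image f ⊤ ∣ ≡ m
∣image⊤∣ {zero} {n} f inj = trans (cong ∣_∣ (⊆-antisym {i = image f ⊤} {j = ⊥}
  (λ y∈ → contradiction (proj₁ (image-∈⁻ f ⊤ y∈)) λ ()) (λ y∈ → contradiction y∈ ∉⊥))) (∣⊥∣≡0 n)
∣image⊤∣ {suc m} f inj = trans (cong ∣_∣ insert) (trans (∣[]≔inside∣ (image (f ∘ suc) ⊤) (f zero) fresh)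
  (cong suc (∣image⊤∣ (f ∘ suc) (λ eq → Fin.suc-injective (inj eq)))))
  where
  rest = image (f ∘ suc) ⊤
  fresh : ¬ f zero ∈ˢ rest
  fresh f0∈ with image-∈⁻ (f ∘ suc) ⊤ f0∈
  ... | x , _ , eq with inj eq
  ...   | ()
  insert-∈ : ∀ {y} → y ∈ˢ rest → y ∈ˢ rest [ f zero ]≔ inside
  insert-∈ {y} y∈ with y Fin.≟ f zero
  ... | yes refl = contradiction y∈ fresh
  ... | no y≢ = lookup⇒[]= y _ (trans (lookup∘update′ y≢ rest inside) ([]=⇒lookup y∈))
  insert : image f ⊤ ≡ rest [ f zero ]≔ inside
  insert = ⊆-antisym to from
    where
    to : ∀ {y} → y ∈ˢ image f ⊤ → y ∈ˢ rest [ f zero ]≔ inside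
    to y∈ with image-∈⁻ f ⊤ y∈
    ... | zero  , _ , refl = lookup⇒[]= (f zero) _ (lookup∘update (f zero) rest inside)
    ... | suc x , _ , refl = insert-∈ (image-∈⁺ (f ∘ suc) ⊤ ∈⊤)
    from : ∀ {y} → y ∈ˢ rest [ f zero ]≔ inside → y ∈ˢ image f ⊤
    from {y} y∈ with y Fin.≟ f zero
    ... | yes refl = image-∈⁺ f ⊤ ∈⊤
    ... | no y≢ with image-∈⁻ (f ∘ suc) ⊤ (lookup⇒[]= y rest (trans (sym (lookup∘update′ y≢ rest inside)) ([]=⇒lookup y∈)))
    ...   | x , _ , refl = image-∈⁺ f ⊤ ∈⊤

lookup-concat : ∀ {A : Set} {t q} (xss : Vec (Vec A q) t) i j → Vec.lookup (Vec.concat xss) (combine i j) ≡ Vec.lookup (Vec.lookup xss i) j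
lookup-concat (xs ∷ xss) zero    j = lookup-++ˡ xs (Vec.concat xss) j
lookup-concat (xs ∷ xss) (suc i) j = trans (lookup-++ʳ xs (Vec.concat xss) (combine i j)) (lookup-concat xss i j)

module KVertices (s t q : ℕ) where

  X : Fin s → Fin (s + t ℕ.* q)
  X x = x ↑ˡ (t ℕ.* q)

  Y : Fin t → Fin q → Fin (s + t ℕ.* q)
  Y i l = s ↑ʳ combine i l

  X-injective : ∀ {x x′} → X x ≡ X x′ → x ≡ x′
  X-injective {x} {x′} = ↑ˡ-injective (t ℕ.* q) x x′

  Y-injectiveˡ : ∀ {i i′ l l′} → Y i l ≡ Y i′ l′ → i ≡ i′
  Y-injectiveˡ {i} {i′} {l} {l′} eq = combine-injectiveˡ i l i′ l′ (↑ʳ-injective s (combine i l) (combine i′ l′) eq)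

  X≢Y : ∀ {x i l} → X x ≢ Y i l
  X≢Y {x} {i} {l} eq with trans (sym (splitAt-↑ˡ s x (t ℕ.* q))) (trans (cong (splitAt s) eq) (splitAt-↑ʳ s (t ℕ.* q) (combine i l)))
  ... | ()

  X∈ : ∀ x i → X x ∈ˢ K-edge s t q x i
  X∈ x i = lookup⇒[]= (X x) (K-edge s t q x i) (trans (lookup-++ˡ ⁅ x ⁆ _ x) ([]=⇒lookup (x∈⁅x⁆ x)))

  Y∈ : ∀ x i l → Y i l ∈ˢ K-edge s t q x i
  Y∈ x i l = lookup⇒[]= (Y i l) (K-edge s t q x i) (trans (lookup-++ʳ ⁅ x ⁆ (Vec.concat blocks) (combine i l))
    (trans (lookup-concat blocks i l) (trans (cong (λ p → Vec.lookup p l) (lookup∘update i (Vec.replicate t ⊥) ⊤)) (lookup-replicate l inside))))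
    where blocks = Vec.replicate t (⊥ {q}) [ i ]≔ ⊤

  ∈K-edge⁻ : ∀ x i {v} → v ∈ˢ K-edge s t q x i → v ≡ X x ⊎ ∃ λ l → v ≡ Y i l
  ∈K-edge⁻ x i {v} v∈ with splitAt s v in eq
  ... | inj₁ x′ = inj₁ (trans (sym x′≡v) (cong X (x∈⁅y⁆⇒x≡y x (lookup⇒[]= x′ ⁅ x ⁆
      (trans (sym (lookup-++ˡ ⁅ x ⁆ _ x′)) (trans (cong (Vec.lookup (K-edge s t q x i)) x′≡v) ([]=⇒lookup v∈)))))))
    where
    x′≡v : X x′ ≡ v
    x′≡v = splitAt⁻¹-↑ˡ eq
  ... | inj₂ w = inj₂ (l , trans (sym Y≡v) (cong (λ i → Y i l) i′≡i))
    where
    i′ = proj₁ (remQuot {t} q w)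
    l  = proj₂ (remQuot {t} q w)
    blocks = Vec.replicate t (⊥ {q}) [ i ]≔ ⊤
    Y≡v : Y i′ l ≡ v
    Y≡v = trans (cong (s ↑ʳ_) (combine-remQuot {t} q w)) (splitAt⁻¹-↑ʳ eq)
    l∈ : Vec.lookup (Vec.lookup blocks i′) l ≡ inside
    l∈ = trans (sym (lookup-concat blocks i′ l)) (trans (sym (lookup-++ʳ ⁅ x ⁆ (Vec.concat blocks) (combine i′ l)))
      (trans (cong (Vec.lookup (K-edge s t q x i)) Y≡v) ([]=⇒lookup v∈)))
    i′≡i : i′ ≡ i
    i′≡i with i′ Fin.≟ i
    ... | yes i′≡i = i′≡i
    ... | no  i′≢i with trans (sym l∈) (trans (cong (λ p → Vec.lookup p l) (trans (lookup∘update′ i′≢i (Vec.replicate t ⊥) ⊤) (lookup-replicate i′ ⊥))) (lookup-replicate l outside))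
    ...   | ()

-- Modulo `suc M′`, adding `c * M′` acts as subtracting `c`.
+-%-cancelʳ : ∀ M c {x y} .{{_ : NonZero M}} → x < M → y < M → (x + c) % M ≡ (y + c) % M → x ≡ y
+-%-cancelʳ (suc M′) c {x} {y} x<M y<M eq = trans (sym (reduce x x<M)) (trans (cong (λ z → (z + c ℕ.* M′ % M) % M) eq) (reduce y y<M))
  where
  M = suc M′
  reduce : ∀ x → x < M → ((x + c) % M + c ℕ.* M′ % M) % M ≡ x
  reduce x x<M = trans (sym (%-distribˡ-+ (x + c) (c ℕ.* M′) M)) (trans (cong (_% M)
    (solve 3 (λ x c m → x :+ c :+ c :* m := x :+ c :* (con 1 :+ m)) refl x c M′))
    (trans ([m+kn]%n≡m%n x c M) (m<n⇒m%n≡m x<M)))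
    where open +-*-Solver using (solve; _:=_; _:+_; _:*_; con)

-- The block b ∈ Fin (2 * k) is read as a pair (side, index), and the edges are the
-- transversals of the blocks whose colours sum to a fixed residue.
module Transversals {Q M T d k n} .{{_ : NonZero k}} (colouring : Colouring Q (suc M) T (suc (suc d)))
  (2kQ≤n : 2 ℕ.* k ℕ.* Q ≤ n) (Q>0 : 0 < Q) where

  open Colouring colouring

  R = 2 ℕ.* k

  vertex : Fin R → Fin Q → Fin n
  vertex b x = inject≤ (combine b x) 2kQ≤n

  vertex-injective : ∀ {b x b′ x′} → vertex b x ≡ vertex b′ x′ → b ≡ b′ × x ≡ x′
  vertex-injective {b} {x} {b′} {x′} eq = combine-injective b x b′ x′ (inject≤-injective 2kQ≤n 2kQ≤n (combine b x) (combine b′ x′) eq)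

  Transversal : Set
  Transversal = Fin R → Fin Q

  pairColour : Transversal → Fin k → ℕ
  pairColour z c = toℕ (colour (z (combine {2} zero c)) (z (combine {2} (suc zero) c)))

  residue : Transversal → Fin (suc M)
  residue z = fromℕ< (m%n<n (∑.sum (pairColour z)) (suc M))

  edge : Transversal → Subset n
  edge z = image (λ b → vertex b (z b)) ⊤

  edge-size : ∀ z → ∣ edge z ∣ ≡ R
  edge-size z = ∣image⊤∣ (λ b → vertex b (z b)) (λ eq → proj₁ (vertex-injective eq))

  edge-injective : ∀ {z z′} → edge z ≡ edge z′ → z ≗ z′
  edge-injective {z} {z′} eq b with image-∈⁻ (λ b → vertex b (z′ b)) ⊤ (subst (vertex b (z b) ∈ˢ_) eq (image-∈⁺ (λ b → vertex b (z b)) ⊤ ∈⊤))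
  ... | b′ , _ , v≡ with vertex-injective v≡
  ...   | refl , z′b≡zb = sym z′b≡zb

  -- Only the pair `c` notices the change of block, so its two colours are congruent modulo `suc M`;
  -- being numbers below `suc M`, they are equal.
  residue-local : ∀ {z z′} ε (c : Fin k) → residue z ≡ residue z′ → (∀ b → b ≢ combine {2} ε c → z b ≡ z′ b) → pairColour z c ≡ pairColour z′ c
  residue-local {z} {z′} ε c eq off = +-%-cancelʳ (suc M) (rest z) (toℕ<n _) (toℕ<n _) (begin
    (pairColour z c + rest z) % suc M       ≡⟨ cong (_% suc M) (split z) ⟨
    ∑.sum (pairColour z) % suc M            ≡⟨ toℕ-fromℕ< _ ⟨
    toℕ (residue z)                         ≡⟨ cong toℕ eq ⟩
    toℕ (residue z′)                        ≡⟨ toℕ-fromℕ< _ ⟩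
    ∑.sum (pairColour z′) % suc M           ≡⟨ cong (_% suc M) (split z′) ⟩
    (pairColour z′ c + rest z′) % suc M     ≡⟨ cong (λ r → (pairColour z′ c + r) % suc M) (same-rest off) ⟨
    (pairColour z′ c + rest z) % suc M      ∎)
    where
    open ≡.≡-Reasoning
    restOf : ∀ {m} → (Fin m → ℕ) → Fin m → ℕ
    restOf {suc m} f c = ∑.sum (f ∘ punchIn c)
    rest : Transversal → ℕ
    rest z = restOf (pairColour z) c
    splitOf : ∀ {m} (f : Fin m → ℕ) c → ∑.sum f ≡ f c + restOf f c
    splitOf {suc m} f c = ∑.sum-remove {i = c} f
    split : ∀ z → ∑.sum (pairColour z) ≡ pairColour z c + rest z
    split z = splitOf (pairColour z) c
    restOf-cong : ∀ {m} {f f′ : Fin m → ℕ} c → (∀ c′ → c′ ≢ c → f c′ ≡ f′ c′) → restOf f c ≡ restOf f′ c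
    restOf-cong {suc m} c h = ∑.sum-cong-≗ (λ i → h (punchIn c i) (punchInᵢ≢i c i))
    same-rest : (∀ b → b ≢ combine {2} ε c → z b ≡ z′ b) → rest z ≡ rest z′
    same-rest off = restOf-cong c λ c′ c′≢c → cong₂ (λ x y → toℕ (colour x y))
      (off (combine {2} zero c′) (λ eq → c′≢c (proj₂ (combine-injective {2} zero c′ ε c eq))))
      (off (combine {2} (suc zero) c′) (λ eq → c′≢c (proj₂ (combine-injective {2} (suc zero) c′ ε c eq))))

  partner : Fin 2 → Fin 2
  partner zero       = suc zero
  partner (suc zero) = zero

  partner≢ : ∀ ε → partner ε ≢ ε
  partner≢ zero ()
  partner≢ (suc zero) ()

  colour-local : ∀ {z z′} ε (c : Fin k) → residue z ≡ residue z′ → (∀ b → b ≢ combine {2} ε c → z b ≡ z′ b) →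
    colour (z (combine {2} ε c)) (z (combine {2} (partner ε) c)) ≡ colour (z′ (combine {2} ε c)) (z′ (combine {2} (partner ε) c))
  colour-local zero       c eq off = toℕ-injective (residue-local zero c eq off)
  colour-local (suc zero) c eq off = trans (colour-sym _ _) (trans (toℕ-injective (residue-local (suc zero) c eq off)) (colour-sym _ _))

  module NoCopy {t q} (φX : Fin (suc (suc d)) → Fin n) (φY : Fin (suc t) → Fin q → Fin n) (ρ : Fin (suc M))
    (φX-injective : Injective _≡_ _≡_ φX) (φX≢φY : ∀ {x i l} → φX x ≢ φY i l)
    (φY-injectiveˡ : ∀ {i i′ l l′} → φY i l ≡ φY i′ l′ → i ≡ i′)
    (z : Fin (suc (suc d)) → Fin (suc t) → Transversal) (z-residue : ∀ x i → residue (z x i) ≡ ρ)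
    (X-covered : ∀ x i → ∃ λ b → vertex b (z x i b) ≡ φX x)
    (Y-covered : ∀ x i l → ∃ λ b → vertex b (z x i b) ≡ φY i l)
    (covering : ∀ x i b → vertex b (z x i b) ≡ φX x ⊎ ∃ λ l → vertex b (z x i b) ≡ φY i l) where

    b₀ : Fin R
    b₀ = proj₁ (X-covered zero zero)

    -- An edge has one vertex in each block. If the edge of `x` and the first (2k-1)-set met `b₀` in
    -- a vertex of that set, the edge of `zero` and the same set would contain this vertex in `b₀`
    -- besides `φX zero`.
    same-block : ∀ x → ∃ λ w → vertex b₀ w ≡ φX x
    same-block x with X-covered x zero
    ... | b , eq with covering x zero b₀
    ...   | inj₁ eq′ = _ , eq′
    ...   | inj₂ (l , eq′) with Y-covered zero zero l
    ...     | b′ , eq″ with vertex-injective (trans eq″ (sym eq′))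
    ...       | refl , _ = contradiction (trans (sym (proj₂ (X-covered zero zero))) eq″) φX≢φY

    w : Fin (suc (suc d)) → Fin Q
    w x = proj₁ (same-block x)

    w-injective : Injective _≡_ _≡_ w
    w-injective {x} {x′} eq = φX-injective (trans (sym (proj₂ (same-block x))) (trans (cong (vertex b₀) eq) (proj₂ (same-block x′))))

    z-b₀ : ∀ x i → z x i b₀ ≡ w x
    z-b₀ x i with X-covered x i
    ... | b , eq with vertex-injective (trans eq (sym (proj₂ (same-block x))))
    ...   | refl , z≡w = z≡w

    Y-block : ∀ x i b → b ≢ b₀ → ∃ λ l → vertex b (z x i b) ≡ φY i l
    Y-block x i b b≢b₀ with covering x i b
    ... | inj₁ eq = contradiction (proj₁ (vertex-injective (trans eq (sym (proj₂ (same-block x)))))) b≢b₀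
    ... | inj₂ p  = p

    -- Outside `b₀` both edges run through the same (2k-1)-set, and each has a single vertex in
    -- every block.
    off-b₀ : ∀ x x′ i b → b ≢ b₀ → z x i b ≡ z x′ i b
    off-b₀ x x′ i b b≢b₀ with Y-block x i b b≢b₀
    ... | l , eq with Y-covered x′ i l
    ...   | b′ , eq′ with vertex-injective (trans eq (sym eq′))
    ...     | refl , z≡z = z≡z

    ε : Fin 2
    ε = proj₁ (remQuot {2} k b₀)

    c : Fin k
    c = proj₂ (remQuot {2} k b₀)

    b₀≡ : combine {2} ε c ≡ b₀
    b₀≡ = combine-remQuot {2} k b₀

    b₁ : Fin R
    b₁ = combine {2} (partner ε) c

    b₁≢b₀ : b₁ ≢ b₀
    b₁≢b₀ eq = partner≢ ε (proj₁ (combine-injective {2} (partner ε) c ε c (trans eq (sym b₀≡))))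

    y : Fin (suc t) → Fin Q
    y i = z zero i b₁

    -- The block `b₁` differs from `b₀`, so these vertices belong to the (2k-1)-sets, which are
    -- pairwise disjoint.
    y-injective : Injective _≡_ _≡_ y
    y-injective {i} {i′} eq = φY-injectiveˡ (trans (sym (proj₂ (Y-block zero i b₁ b₁≢b₀)))
      (trans (cong (vertex b₁) eq) (proj₂ (Y-block zero i′ b₁ b₁≢b₀))))

    agree : ∀ x x′ i → colour (w x) (y i) ≡ colour (w x′) (y i)
    agree x x′ i = begin
      colour (w x) (y i)                             ≡⟨ cong₂ colour (at-b₀ x) (off-b₀ x zero i b₁ b₁≢b₀) ⟨
      colour (z x i (combine {2} ε c)) (z x i b₁)    ≡⟨ colour-local {z x i} {z x′ i} ε c (trans (z-residue x i) (sym (z-residue x′ i)))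
        (λ b b≢ → off-b₀ x x′ i b (λ eq → b≢ (trans eq (sym b₀≡)))) ⟩
      colour (z x′ i (combine {2} ε c)) (z x′ i b₁)  ≡⟨ cong₂ colour (at-b₀ x′) (off-b₀ x′ zero i b₁ b₁≢b₀) ⟩
      colour (w x′) (y i)                            ∎
      where
      open ≡.≡-Reasoning
      at-b₀ : ∀ x → z x i (combine {2} ε c) ≡ w x
      at-b₀ x = trans (cong (z x i) b₀≡) (z-b₀ x i)

    t≤T : suc t ≤ T
    t≤T = agree≤ w y w-injective y-injective agree

  transversals : ℕ
  transversals = Q ℕ.^ R

  open Fibres {transversals} (λ τ → residue (finToFun τ))

  instance
    transversals≢0 : NonZero transversals
    transversals≢0 = ℕ.m^n≢0 Q R {{ℕ.>-nonZero Q>0}}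

  abstract
    best : ∃ λ ρ → transversals ≤ suc M ℕ.* length (fibre ρ)
    best = large-fibre

  ρ : Fin (suc M)
  ρ = proj₁ best

  G : Hypergraph R n
  G = hypergraph (List.map (edge ∘ finToFun) (fibre ρ))
    (ListAll.tabulate λ e∈ → let (τ , _ , e≡) = ∈-map⁻ (edge ∘ finToFun) e∈ in trans (cong ∣_∣ e≡) (edge-size (finToFun τ)))
    (Unique.map⁺ (λ eq → finToFun-injective {Q} {R} (edge-injective eq)) (fibre-unique ρ))

  G-free : ∀ t → T < t → ¬ K R (suc (suc d)) t {{ℕ.m*n≢0 2 k}} ⊑ G
  G-free (suc t) T<t (φ , φ-injective , copies) = ℕ.<⇒≱ T<t (NoCopy.t≤T φX φY ρ
    (λ eq → X-injective (φ-injective eq)) (λ {x} {i} {l} eq → X≢Y {x} {i} {l} (φ-injective eq)) (λ {i} {i′} {l} {l′} eq → Y-injectiveˡ {i} {i′} {l} {l′} (φ-injective eq))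
    z z-residue X-covered Y-covered covering)
    where
    s = suc (suc d)
    q = R ℕ.∸ 1
    open KVertices s (suc t) q
    φX : Fin s → Fin n
    φX x = φ (X x)
    φY : Fin (suc t) → Fin q → Fin n
    φY i l = φ (Y i l)
    copy : ∀ x i → ∃ λ τ → τ ∈ fibre ρ × image φ (K-edge s (suc t) q x i) ≡ edge (finToFun τ)
    copy x i = ∈-map⁻ (edge ∘ finToFun) (ListAll.lookup copies (∈-deduplicate⁺ _≟ˢ_ (∈-cartesianProductWith⁺ (K-edge s (suc t) q) (∈-allFin x) (∈-allFin i))))
    z : Fin s → Fin (suc t) → Transversal
    z x i = finToFun (proj₁ (copy x i))
    z-residue : ∀ x i → residue (z x i) ≡ ρ
    z-residue x i = proj₂ (∈-filter⁻ (λ τ → residue (finToFun τ) Fin.≟ ρ) {xs = allFin transversals} (proj₁ (proj₂ (copy x i))))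
    same : ∀ x i → image φ (K-edge s (suc t) q x i) ≡ edge (z x i)
    same x i = proj₂ (proj₂ (copy x i))
    covered : ∀ x i {v} → v ∈ˢ K-edge s (suc t) q x i → ∃ λ b → vertex b (z x i b) ≡ φ v
    covered x i {v} v∈ = let (b , _ , eq) = image-∈⁻ (λ b → vertex b (z x i b)) ⊤ (subst (φ v ∈ˢ_) (same x i) (image-∈⁺ φ (K-edge s (suc t) q x i) v∈)) in b , eq
    X-covered : ∀ x i → ∃ λ b → vertex b (z x i b) ≡ φX x
    X-covered x i = covered x i (X∈ x i)
    Y-covered : ∀ x i l → ∃ λ b → vertex b (z x i b) ≡ φY i l
    Y-covered x i l = covered x i (Y∈ x i l)
    covering : ∀ x i b → vertex b (z x i b) ≡ φX x ⊎ ∃ λ l → vertex b (z x i b) ≡ φY i l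
    covering x i b = locate (image-∈⁻ φ (K-edge s (suc t) q x i)
        (subst (vertex b (z x i b) ∈ˢ_) (sym (same x i)) (image-∈⁺ (λ b → vertex b (z x i b)) ⊤ ∈⊤)))
      where
      locate : (∃ λ v → v ∈ˢ K-edge s (suc t) q x i × φ v ≡ vertex b (z x i b)) → vertex b (z x i b) ≡ φX x ⊎ ∃ λ l → vertex b (z x i b) ≡ φY i l
      locate (v , v∈ , eq) = Sum.map (λ v≡ → trans (sym eq) (cong φ v≡)) (λ (l , v≡) → l , trans (sym eq) (cong φ v≡)) (∈K-edge⁻ x i v∈)

  transversals≤ : ∀ t → T < t → Q ℕ.^ (2 ℕ.* k) ≤ suc M ℕ.* ex n (K (2 ℕ.* k) (suc (suc d)) t {{ℕ.m*n≢0 2 k}})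
  transversals≤ t T<t = ℕ.≤-trans (proj₂ best) (ℕ.*-monoʳ-≤ (suc M)
    (ℕ.≤-trans (ℕ.≤-reflexive (sym (length-map (edge ∘ finToFun) (fibre ρ)))) (ex-upper (K R (suc (suc d)) t {{ℕ.m*n≢0 2 k}}) G (G-free t T<t))))

-- Choice of parameters

last-true : ∀ {P : ℕ → Set} → Relation.Unary.Decidable P → P 0 → ∀ b → ¬ P b → ∃ λ x → P x × ¬ P (suc x)
last-true P? p zero    ¬p = contradiction p ¬p
last-true P? p (suc b) ¬p with P? b
... | yes q = b , q , ¬p
... | no ¬q = last-true P? p b ¬q

*-cancelʳ-≤′ : ∀ {m n o} → 0 < o → m * o ≤ n * o → m ≤ n
*-cancelʳ-≤′ {m} {n} {suc o} _ = ℕ.*-cancelʳ-≤ m n (suc o)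

^-distribʳ-* : ∀ x y k → (x * y) ^ k ≡ x ^ k * y ^ k
^-distribʳ-* x y zero    = refl
^-distribʳ-* x y (suc k) = trans (cong (x * y *_) (^-distribʳ-* x y k))
  (solve 4 (λ x y a b → x :* y :* (a :* b) := x :* a :* (y :* b)) refl x y (x ^ k) (y ^ k))
  where open +-*-Solver using (solve; _:=_; _:*_)

n<2^n : ∀ n → n < 2 ^ n
n<2^n zero    = s≤s z≤n
n<2^n (suc n) = ℕ.≤-trans (s≤s (n<2^n n)) (ℕ.≤-trans (ℕ.+-monoˡ-≤ (2 ^ n) (ℕ.m^n>0 2 n)) (ℕ.+-monoʳ-≤ (2 ^ n) (ℕ.m≤m+n (2 ^ n) 0)))

2+ : ∀ {n} → 2 ≤ n → ∃ λ m → n ≡ suc (suc m)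
2+ {suc (suc m)} _ = m , refl
2+ {suc zero} (s≤s ())

-- In all inequalities between powers below, w = 2k(s - 1) - 1 and Q = q^(s-1).
combine-bounds : ∀ d R w Q q h N X n t B {M} → R * d ≡ suc w → 0 < Q → q ^ d ≡ Q →
  M * h ≤ 2 * q → N ≡ Q ^ R → N ≤ M * X → n ≤ B * Q → t ≤ (5 * h) ^ d * d ! →
  t * n ^ w ≤ 5 ^ d * d ! * B ^ w * 2 ^ d * X ^ d
combine-bounds d R w Q q h N X n t B {M} Rd≡ Q>0 q^d≡ Mh≤ N≡ N≤ n≤ t≤ = begin
  t * n ^ w                                                   ≤⟨ ℕ.*-mono-≤ t≤ (ℕ.^-monoˡ-≤ w n≤) ⟩
  (5 * h) ^ d * d ! * (B * Q) ^ w                             ≡⟨ cong₂ (λ x y → x * d ! * y) (^-distribʳ-* 5 h d) (^-distribʳ-* B Q w) ⟩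
  5 ^ d * h ^ d * d ! * (B ^ w * Q ^ w)                       ≡⟨ solve 5 (λ a b c e f → a :* b :* c :* (e :* f) := a :* c :* e :* (b :* f)) refl (5 ^ d) (h ^ d) (d !) (B ^ w) (Q ^ w) ⟩
  5 ^ d * d ! * B ^ w * (h ^ d * Q ^ w)                       ≤⟨ ℕ.*-monoʳ-≤ (5 ^ d * d ! * B ^ w) core ⟩
  5 ^ d * d ! * B ^ w * (2 ^ d * X ^ d)                       ≡⟨ ℕ.*-assoc (5 ^ d * d ! * B ^ w) (2 ^ d) (X ^ d) ⟨
  5 ^ d * d ! * B ^ w * 2 ^ d * X ^ d                         ∎
  where
  open ℕ.≤-Reasoning
  open +-*-Solver using (solve; _:=_; _:*_)
  -- The d-th power of `h * Q ^ R ≤ M * h * X ≤ 2 * q * X` turns `q` into `Q`; cancelling this one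
  -- factor `Q` leaves the exponent `w`.
  core : h ^ d * Q ^ w ≤ 2 ^ d * X ^ d
  core = *-cancelʳ-≤′ Q>0 (begin
    h ^ d * Q ^ w * Q          ≡⟨ solve 3 (λ a b c → a :* b :* c := a :* (c :* b)) refl (h ^ d) (Q ^ w) Q ⟩
    h ^ d * Q ^ suc w          ≡⟨ cong (λ k → h ^ d * Q ^ k) Rd≡ ⟨
    h ^ d * Q ^ (R * d)        ≡⟨ cong (h ^ d *_) (ℕ.^-*-assoc Q R d) ⟨
    h ^ d * (Q ^ R) ^ d        ≡⟨ ^-distribʳ-* h (Q ^ R) d ⟨
    (h * Q ^ R) ^ d            ≤⟨ ℕ.^-monoˡ-≤ d (ℕ.*-monoʳ-≤ h (subst (_≤ M * X) N≡ N≤)) ⟩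
    (h * (M * X)) ^ d          ≡⟨ cong (_^ d) (solve 3 (λ h m x → h :* (m :* x) := m :* h :* x) refl h M X) ⟩
    (M * h * X) ^ d            ≤⟨ ℕ.^-monoˡ-≤ d (ℕ.*-monoˡ-≤ X Mh≤) ⟩
    (2 * q * X) ^ d            ≡⟨ trans (^-distribʳ-* (2 * q) X d) (cong (_* X ^ d) (^-distribʳ-* 2 q d)) ⟩
    2 ^ d * q ^ d * X ^ d      ≡⟨ cong (λ y → 2 ^ d * y * X ^ d) q^d≡ ⟩
    2 ^ d * Q * X ^ d          ≡⟨ solve 3 (λ a b c → a :* b :* c := a :* c :* b) refl (2 ^ d) Q (X ^ d) ⟩
    2 ^ d * X ^ d * Q          ∎)

-- This leaves room for the exponent `h * h + 1`, whose power of two exceeds `h * h` as the choice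
-- of `g` demands.
threshold : ℕ → ℕ → ℕ → ℕ
threshold R d h = R * 2 ^ (suc (h * h) * d)

-- The exponent is one that fits while its successor does not. The next field is `2 ^ d` times as
-- large, so `n` exceeds `2 ^ (a * d)` by at most the factor `R * 2 ^ d`.
fieldSize : ∀ R d h n → 0 < R → 0 < d → threshold R d h ≤ n →
  ∃ λ a → h * h < 2 ^ a × 2 ≤ 2 ^ a × R * 2 ^ (a * d) ≤ n × n ≤ R * 2 ^ d * 2 ^ (a * d)
fieldSize R d h n R>0 d>0 n₀≤n with last-true (λ x → R * 2 ^ ((suc (h * h) + x) * d) ℕ.≤? n) base n too-large
  where
  base : R * 2 ^ ((suc (h * h) + 0) * d) ≤ n
  base = subst (λ a → R * 2 ^ (a * d) ≤ n) (sym (ℕ.+-identityʳ (suc (h * h)))) n₀≤n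
  too-large : ¬ R * 2 ^ ((suc (h * h) + n) * d) ≤ n
  too-large = ℕ.<⇒≱ (ℕ.<-≤-trans (n<2^n n) (ℕ.≤-trans (ℕ.^-monoʳ-≤ 2 n≤) (ℕ.m≤n*m _ R {{ℕ.>-nonZero R>0}})))
    where
    n≤ : n ≤ (suc (h * h) + n) * d
    n≤ = ℕ.≤-trans (ℕ.m≤n+m n (suc (h * h))) (ℕ.m≤m*n _ d {{ℕ.>-nonZero d>0}})
... | x , fits , exceeds = a , ℕ.<-≤-trans (n<2^n (h * h)) (ℕ.^-monoʳ-≤ 2 {h * h} {a} (ℕ.≤-trans (ℕ.n≤1+n (h * h)) (ℕ.m≤m+n (suc (h * h)) x))) ,
    ℕ.^-monoʳ-≤ 2 {1} {a} (s≤s z≤n) , fits ,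
    ℕ.≤-trans (ℕ.<⇒≤ (ℕ.≰⇒> exceeds)) (ℕ.≤-reflexive (trans (cong (λ y → R * 2 ^ (y * d)) (ℕ.+-suc (suc (h * h)) x))
      (trans (cong (R *_) (ℕ.^-distribˡ-+-* 2 d (a * d))) (sym (ℕ.*-assoc R (2 ^ d) (2 ^ (a * d)))))))
  where a = suc (h * h) + x

ratioCount : ℕ → ℕ → ℕ
ratioCount d h′ = suc (4 * h′) ^ d * d !

-- The hypothesis `d ! < t` says that `h′ = 0` is admissible; the value taken is one whose successor
-- no longer is.
colourParameter : ∀ d t → 0 < d → d ! < t → ∃ λ h′ → ratioCount d h′ < t × t ≤ (5 * suc h′) ^ d * d !
colourParameter d t d>0 d!<t with last-true (λ h′ → ratioCount d h′ ℕ.<? t) base t too-large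
  where
  base : ratioCount d 0 < t
  base = subst (_< t) (sym (trans (cong (_* d !) (ℕ.^-zeroˡ d)) (ℕ.*-identityˡ (d !)))) d!<t
  too-large : ¬ ratioCount d t < t
  too-large = ℕ.≤⇒≯ (ℕ.≤-trans (ℕ.≤-trans (ℕ.≤-trans (ℕ.m≤n*m t 4) (ℕ.n≤1+n _))
    (ℕ.≤-trans (ℕ.≤-reflexive (sym (ℕ.^-identityʳ _))) (ℕ.^-monoʳ-≤ (suc (4 * t)) d>0))) (ℕ.m≤m*n _ (d !) {{d ℕ.!≢0}}))
-- For the successor the base is `4 * h′ + 5`, which is at most `5 * suc h′`.
... | h′ , small , large = h′ , small , ℕ.≤-trans (ℕ.≮⇒≥ large) (ℕ.*-monoˡ-≤ (d !) (ℕ.^-monoˡ-≤ d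
    (ℕ.≤-trans (ℕ.≤-reflexive (solve 1 (λ h → con 1 :+ con 4 :* (con 1 :+ h) := con 5 :+ con 4 :* h) refl h′))
      (ℕ.≤-trans (ℕ.+-monoʳ-≤ 5 (ℕ.*-monoˡ-≤ h′ (ℕ.n≤1+n 4))) (ℕ.≤-reflexive (sym (ℕ.*-suc 5 h′)))))))
  where open +-*-Solver using (solve; _:=_; _:+_; _:*_; con)

constant : ℕ → ℕ → ℕ
constant d R = 5 ^ d * d ! * (R * 2 ^ d) ^ (R * d ∸ 1) * 2 ^ d

norm-colouring-bound : ∀ a d′ e r h′ k n t .{{_ : NonZero k}} → 2 ^ a ≡ suc (suc e) → 2 ^ (a * suc d′) ≡ suc (suc r) →
  suc h′ * suc h′ < 2 ^ a → 2 * k * 2 ^ (a * suc d′) ≤ n → ratioCount (suc d′) h′ < t →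
  ∃ λ M → M * suc h′ ≤ 2 * 2 ^ a × (2 ^ (a * suc d′)) ^ (2 * k) ≤ M * ex n (K (2 * k) (suc (suc d′)) t {{m*n≢0 2 k}})
norm-colouring-bound a d′ e r h′ k n t q≡ Q≡ h²<q fits T<t = use (NormColouring.colouring a d′ e r q≡ Q≡ (finiteField (a * suc d′) r Q≡) h′ h²<q)
  where
  Q = 2 ^ (a * suc d′)
  use : (∃ λ M → suc M * suc h′ ≤ 2 * 2 ^ a × Colouring Q (suc M) (ratioCount (suc d′) h′) (suc (suc d′))) →
    ∃ λ M → M * suc h′ ≤ 2 * 2 ^ a × Q ^ (2 * k) ≤ M * ex n (K (2 * k) (suc (suc d′)) t {{m*n≢0 2 k}})
  use (M , few , colouring) = suc M , few , Transversals.transversals≤ {Q} {M} {ratioCount (suc d′) h′} {d′} {k} {n} colouring fits (ℕ.m^n>0 2 (a * suc d′)) t T<t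

assemble : ∀ d R t (X : ℕ → ℕ) → 0 < d → 0 < R → d ! < t →
  (∀ a e r h′ n → 2 ^ a ≡ suc (suc e) → 2 ^ (a * d) ≡ suc (suc r) → suc h′ * suc h′ < 2 ^ a →
    R * 2 ^ (a * d) ≤ n → ratioCount d h′ < t →
    ∃ λ M → M * suc h′ ≤ 2 * 2 ^ a × (2 ^ (a * d)) ^ R ≤ M * X n) →
  ∃ λ n₀ → ∀ n → n₀ ≤ n → t * n ^ (R * d ∸ 1) ≤ constant d R * X n ^ d
assemble d R t X d>0 R>0 d!<t colourings =
  let (h′ , T<t , t≤) = colourParameter d t d>0 d!<t
  in threshold R d (suc h′) , λ n n₀≤n →
  let (a , h²<q , 2≤q , fits , n≤) = fieldSize R d (suc h′) n R>0 d>0 n₀≤n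
      (e , q≡) = 2+ 2≤q
      (r , Q≡) = 2+ (ℕ.≤-trans 2≤q (ℕ.^-monoʳ-≤ 2 (ℕ.m≤m*n a d {{ℕ.>-nonZero d>0}})))
      (M , few , many) = colourings a e r h′ n q≡ Q≡ h²<q fits T<t
  in combine-bounds d R (R * d ∸ 1) (2 ^ (a * d)) (2 ^ a) (suc h′) ((2 ^ (a * d)) ^ R) (X n) n t (R * 2 ^ d) {M}
    (sym (ℕ.suc-pred (R * d) {{ℕ.m*n≢0 R d {{ℕ.>-nonZero R>0}} {{ℕ.>-nonZero d>0}}}})) (ℕ.m^n>0 2 (a * d)) (ℕ.^-*-assoc 2 a d) few refl many n≤ t≤

lower-bound : ∀ d′ k .{{_ : NonZero k}} t → suc d′ ! < t → ∃ λ n₀ → ∀ n → n₀ ≤ n →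
  t * n ^ (2 * k * suc d′ ∸ 1) ≤ constant (suc d′) (2 * k) * ex n (K (2 * k) (suc (suc d′)) t {{m*n≢0 2 k}}) ^ suc d′
lower-bound d′ k t d!<t = assemble (suc d′) (2 * k) t (λ n → ex n (K (2 * k) (suc (suc d′)) t {{m*n≢0 2 k}})) (s≤s z≤n)
  (ℕ.>-nonZero⁻¹ (2 * k) {{m*n≢0 2 k}}) d!<t λ a e r h′ n → norm-colouring-bound a d′ e r h′ k n t

-- Passage to a rational constant

1/D*A≤Y : ∀ D A Y → A ≤ suc D * Y → (+ 1 / suc D) ℚ.* (+ A / 1) ℚ.≤ + Y / 1
1/D*A≤Y D A Y A≤ = ℚ.toℚᵘ-cancel-≤ (ℚᵘ.≤-respˡ-≃ (ℚᵘ.≃-sym (ℚᵘ.≃-trans (ℚ.toℚᵘ-homo-* (+ 1 / suc D) (+ A / 1))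
    (ℚᵘ.*-cong (ℚ.toℚᵘ-fromℚᵘ (mkℚᵘ (+ 1) D)) (ℚ.toℚᵘ-fromℚᵘ (mkℚᵘ (+ A) 0)))))
  (ℚᵘ.≤-respʳ-≃ (ℚᵘ.≃-sym (ℚ.toℚᵘ-fromℚᵘ (mkℚᵘ (+ Y) 0))) (*≤* integers)))
  where
  integers : (+ 1 ℤ.* + A) ℤ.* + 1 ℤ.≤ + Y ℤ.* + (suc D * 1)
  integers = subst₂ ℤ._≤_ (sym (trans (ℤ.*-identityʳ (+ 1 ℤ.* + A)) (ℤ.*-identityˡ (+ A)))) (ℤ.pos-* Y (suc D * 1))
    (ℤ.+≤+ (ℕ.≤-trans A≤ (ℕ.≤-reflexive (trans (ℕ.*-comm (suc D) Y) (cong (Y *_) (sym (ℕ.*-identityʳ (suc D))))))))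

^ℚ-unit-interval : ∀ {c} → 0ℚ ℚ.≤ c → c ℚ.≤ 1ℚ → ∀ n → 0ℚ ℚ.≤ c ^ℚ n × c ^ℚ n ℚ.≤ 1ℚ
^ℚ-unit-interval 0≤c c≤1 zero = ℚ.nonNegative⁻¹ 1ℚ , ℚ.≤-refl
^ℚ-unit-interval {c} 0≤c c≤1 (suc n) with ^ℚ-unit-interval 0≤c c≤1 n
... | 0≤cⁿ , cⁿ≤1 = ℚ.≤-trans (ℚ.≤-reflexive (sym (ℚ.*-zeroʳ c))) (ℚ.*-monoˡ-≤-nonNeg c {{ℚ.nonNegative 0≤c}} 0≤cⁿ) ,
  ℚ.≤-trans (ℚ.*-monoˡ-≤-nonNeg c {{ℚ.nonNegative 0≤c}} cⁿ≤1) (ℚ.≤-trans (ℚ.≤-reflexive (ℚ.*-identityʳ c)) c≤1)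

-- The bound is raised to the power `s ∸ 1`, an equivalence between nonnegative quantities, which
-- turns t^(1/(s-1)) n^(2k - 1/(s-1)) into an integer without roots.
theorem1p2 : ∀ (s k : ℕ) .{{_ : NonZero k}} → 2 ≤ s →
    ∃[ c ] (0ℚ ℚ.< c) × (∀ (t : ℕ) → (s ∸ 1) ! < t →
    ∃[ n₀ ] (∀ (n : ℕ) → n₀ ≤ n →
    (c ^ℚ (s ∸ 1)) ℚ.* (+ (t * n ^ (2 * k * (s ∸ 1) ∸ 1)) / 1)
    ℚ.≤ + (ex n (K (2 * k) s t {{m*n≢0 2 k}}) ^ (s ∸ 1)) / 1))
theorem1p2 (suc zero) k (s≤s ())
theorem1p2 (suc (suc d′)) k _ = c , 0<c , λ t d!<t → proj₁ (lower-bound d′ k t d!<t) , λ n n₀≤n →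
  scaled (t * n ^ (2 * k * d ∸ 1)) (ex n (K (2 * k) (suc d) t {{m*n≢0 2 k}}) ^ d)
    (ℕ.≤-trans (proj₂ (lower-bound d′ k t d!<t) n n₀≤n) (ℕ.*-monoˡ-≤ _ (ℕ.n≤1+n (constant d (2 * k)))))
  where
  d = suc d′
  D = constant d (2 * k)
  -- A d-th root of the constant is avoided: as `c ≤ 1`, the power `c ^ℚ d` is at most `c`. The
  -- successor keeps the denominator visibly nonzero.
  c : ℚ
  c = + 1 / suc D
  0<c : 0ℚ ℚ.< c
  0<c = ℚ.positive⁻¹ c {{ℚ.normalize-pos 1 (suc D)}}
  0≤c : 0ℚ ℚ.≤ c
  0≤c = ℚ.<⇒≤ 0<c
  c≤1 : c ℚ.≤ 1ℚ
  c≤1 = ℚ.≤-trans (ℚ.≤-reflexive (sym (ℚ.*-identityʳ c))) (1/D*A≤Y D 1 1 (s≤s z≤n))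
  scaled : ∀ A Y → A ≤ suc D * Y → (c ^ℚ d) ℚ.* (+ A / 1) ℚ.≤ + Y / 1
  scaled A Y A≤ = ℚ.≤-trans (ℚ.*-monoʳ-≤-nonNeg (+ A / 1) {{ℚ.normalize-nonNeg A 1}}
    (ℚ.≤-trans (ℚ.*-monoˡ-≤-nonNeg c {{ℚ.nonNegative 0≤c}} (proj₂ (^ℚ-unit-interval 0≤c c≤1 d′))) (ℚ.≤-reflexive (ℚ.*-identityʳ c))))
    (1/D*A≤Y D A Y A≤)
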